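{- Let $G=(V,E)$ be a locally finite graph, and let $x,y\in V$ with $d(x,y)=\delta\ge 2$ (with $\delta$ a finite integer). Let $p^*\in(0,1)$ be a critical point of $\kappa_p(x,y)$. Then $$p^* \le \frac{1}{2}-\frac{1}{2}\cdot\frac{d_x+d_y}{2d_xd_y-d_x-d_y}.$$
   Context: Graphs have no multiple edges and no self loops. $d_v$ denotes the degree of the vertex $v$, $w\sim v$ means that $w$ and $v$ are adjacent, and $d(v,w)$ is the combinatorial distance (length of a shortest path). For $v\in V$ and $p\in[0,1]$, $\mu_v^p$ is the probability measure on $V$ with $\mu_v^p(v)=p$, $\mu_v^p(z)=\frac{1-p}{d_v}$ if $z\sim v$, and $\mu_v^p(z)=0$ otherwise. For probability measures $\mu_1,\mu_2$ on $V$, the Wasserstein distance is $W_1(\mu_1,\mu_2)=\inf_{\pi}\sum_{v\in V}\sum_{w\in V} d(v,w)\pi(v,w)$, the infimum over all $\pi:V\times V\to[0,1]$ with $\mu_1(v)=\sum_{w}\pi(v,w)$ and $\mu_2(w)=\sum_{v}\pi(v,w)$. The $p$-Ollivier-Ricci curvature is $\kappa_p(x,y)=1-\frac{W_1(\mu_x^p,\mu_y^p)}{d(x,y)}$. A critical point of $\kappa_p(x,y)$ is a value $p^*\in(0,1)$ such that $\lim_{p\to p^{*- }}\frac{\partial}{\partial p}\kappa_p(x,y)\ne\lim_{p\to p^{*+}}\frac{\partial}{\partial p}\kappa_p(x,y)$, i.e. a value of $p$ at which the slope of the piecewise linear function $p\mapsto\kappa_p(x,y)$ changes. -}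

module Defs where

open import Level using (0ℓ)
open import Algebra.Bundles using (CommutativeRing)
import Algebra.Definitions.RawMonoid as RawMonoidDefinitions
open import Data.Empty using (⊥-elim)
open import Data.List using (List; length; foldr)
open import Data.List.Membership.Propositional using (_∈_)
open import Data.List.Relation.Unary.Unique.Propositional using (Unique)
open import Data.Nat as ℕ using (ℕ; zero; suc)
open import Data.Product using (Σ; ∃; _×_; _,_; proj₁; proj₂)
open import Data.Sum using (_⊎_; inj₁; inj₂)
open import Function.Bundles using (_⇔_)
open import Relation.Binary.Core using (Rel)
import Relation.Binary.Construct.StrictToNonStrict as StrictToNonStrict
open import Relation.Binary.Definitions using (Symmetric; tri<; tri≈; tri>)
open import Relation.Binary.PropositionalEquality using (_≡_)
open import Relation.Binary.Structures using (IsStrictTotalOrder)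
open import Relation.Nullary using (¬_; Dec; yes; no)
open import Relation.Unary using (Pred)

-- The classical real numbers, given axiomatically as a Dedekind-complete
-- ordered field; these axioms determine ℝ up to isomorphism.
record RealNumbers : Set₁ where
  field
    commutativeRing : CommutativeRing 0ℓ 0ℓ

  open CommutativeRing commutativeRing public

  infix  4 _<_
  infix  8 _⁻¹
  infixl 7 _/_

  field
    _<_                : Rel Carrier 0ℓ
    isStrictTotalOrder : IsStrictTotalOrder _≈_ _<_
    0<1                : 0# < 1#
    +-monoˡ-<          : ∀ z {x y} → x < y → x + z < y + z
    *-pos              : ∀ {x y} → 0# < x → 0# < y → 0# < x * y

    -- Total for convenience; the axioms say nothing about the value at 0.
    _⁻¹                : Carrier → Carrier
    ⁻¹-cong            : ∀ {x y} → x ≈ y → x ⁻¹ ≈ y ⁻¹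
    *-inverseʳ         : ∀ {x} → ¬ x ≈ 0# → x * x ⁻¹ ≈ 1#

  open StrictToNonStrict _≈_ _<_ public using (_≤_)

  IsUpperBound : Pred Carrier 0ℓ → Pred Carrier 0ℓ
  IsUpperBound S u = ∀ r → S r → r ≤ u

  -- Leastness is stated positively: nothing smaller bounds S because some
  -- element of S exceeds it.
  IsSup : Pred Carrier 0ℓ → Pred Carrier 0ℓ
  IsSup S s = IsUpperBound S s × (∀ z → z < s → ∃ λ r → S r × z < r)

  field
    complete : (S : Pred Carrier 0ℓ) → ∃ S → ∃ (IsUpperBound S) → ∃ (IsSup S)

  private module O = IsStrictTotalOrder isStrictTotalOrder

  -- Completeness and trichotomy yield the classical logic used below: decide P
  -- by comparing with 0 the supremum of {0} ∪ {1 ∣ P}.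
  excluded-middle : (P : Set) → Dec P
  excluded-middle P with complete S (0# , inj₁ refl) (1# , bounded)
    where
    S : Pred Carrier 0ℓ
    S r = r ≈ 0# ⊎ (P × r ≈ 1#)

    bounded : IsUpperBound S 1#
    bounded r (inj₁ r≈0)       = inj₁ (proj₂ O.<-resp-≈ (sym r≈0) 0<1)
    bounded r (inj₂ (_ , r≈1)) = inj₂ r≈1
  ... | s , upper , least with O.compare 0# s
  ...   | tri< 0<s _ _ with least 0# 0<s
  ...     | r , inj₁ r≈0 , 0<r     = ⊥-elim (O.irrefl (sym r≈0) 0<r)
  ...     | r , inj₂ (p , _) , 0<r = yes p
  excluded-middle P | s , upper , least | tri≈ 0≮s _ _ = no λ p → 0≮s (positive p)
    where
    positive : P → 0# < s
    positive p with upper 1# (inj₂ (p , refl))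
    ... | inj₁ 1<s = O.trans 0<1 1<s
    ... | inj₂ 1≈s = proj₁ O.<-resp-≈ 1≈s 0<1
  excluded-middle P | s , upper , least | tri> 0≮s _ _ = no λ p → 0≮s (positive p)
    where
    positive : P → 0# < s
    positive p with upper 1# (inj₂ (p , refl))
    ... | inj₁ 1<s = O.trans 0<1 1<s
    ... | inj₂ 1≈s = proj₁ O.<-resp-≈ 1≈s 0<1

  _/_ : Carrier → Carrier → Carrier
  x / y = x * y ⁻¹

  fromℕ : ℕ → Carrier
  fromℕ n = RawMonoidDefinitions._×_ +-rawMonoid n 1#

  ½ : Carrier
  ½ = 1# / fromℕ 2

  ∣_∣ : Carrier → Carrier
  ∣ r ∣ with O.compare r 0#
  ... | tri< _ _ _ = - r
  ... | tri≈ _ _ _ = r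
  ... | tri> _ _ _ = r

  -- Takes the junk value 0 when S is empty or unbounded above.
  sup : Pred Carrier 0ℓ → Carrier
  sup S with excluded-middle (∃ S × ∃ (IsUpperBound S))
  ... | yes (inhabited , bounded) = proj₁ (complete S inhabited bounded)
  ... | no _                      = 0#

  inf : Pred Carrier 0ℓ → Carrier
  inf S = - sup (λ r → ∃ λ s → S s × r ≈ - s)

  -- Σ_{i ∈ I} f i ≈ s for a family of nonnegative numbers over an arbitrary
  -- index set: s is the supremum of the sums over finite subsets of I.
  HasSum : {I : Set} → (I → Carrier) → Carrier → Set
  HasSum {I} f = IsSup λ r →
    Σ (List I) λ is → Unique is × r ≈ foldr (λ i t → f i + t) 0# is

  -- q ↦ F q tends to L as q → a within D, for a partial function F given by
  -- its graph; F must be defined on D near a.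
  HasLimit : Pred Carrier 0ℓ → Rel Carrier 0ℓ → Carrier → Carrier → Set
  HasLimit D F a L =
    ∀ ε → 0# < ε → ∃ λ η → 0# < η ×
      (∀ q → D q → ∣ q - a ∣ < η → ∃ λ m → F q m × ∣ m - L ∣ < ε)

  HasDerivative : (Carrier → Carrier) → Carrier → Carrier → Set
  HasDerivative f p =
    HasLimit (λ q → ¬ q ≈ p) (λ q m → m ≈ (f q - f p) / (q - p)) p

  IsCriticalPoint : (Carrier → Carrier) → Carrier → Set
  IsCriticalPoint f p =
    0# < p × p < 1# ×
    ∃ λ L → ∃ λ R →
      HasLimit (λ q → q < p) (HasDerivative f) p L ×
      HasLimit (λ q → p < q) (HasDerivative f) p R ×
      ¬ L ≈ R

record LocallyFiniteGraph : Set₁ where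
  infix 4 _~_
  field
    V          : Set
    _~_        : Rel V 0ℓ
    ~-sym      : Symmetric _~_
    ~-irrefl   : ∀ v → ¬ v ~ v
    neighbours : V → List V
    neighbours-unique : ∀ v → Unique (neighbours v)
    ∈-neighbours      : ∀ v w → w ∈ neighbours v ⇔ w ~ v

  degree : V → ℕ
  degree v = length (neighbours v)

  data Walk : V → V → ℕ → Set where
    []  : ∀ {v} → Walk v v zero
    _∷_ : ∀ {u v w n} → u ~ v → Walk v w n → Walk u w (suc n)

  -- d(v,w) = n.  A shortest walk is automatically a path.
  IsDistance : V → V → ℕ → Set
  IsDistance v w n = Walk v w n × (∀ m → Walk v w m → n ℕ.≤ m)

module Curvature (ℝ : RealNumbers) (G : LocallyFiniteGraph) where
  open RealNumbers ℝ
  open LocallyFiniteGraph G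

  μ : Carrier → V → V → Carrier
  μ p v z with excluded-middle (z ≡ v) | excluded-middle (z ~ v)
  ... | yes _ | _     = p
  ... | no  _ | yes _ = (1# - p) / fromℕ (degree v)
  ... | no  _ | no  _ = 0#

  record IsTransportPlan (μ₁ μ₂ : V → Carrier) (π : V → V → Carrier) : Set where
    field
      nonNegative : ∀ v w → 0# ≤ π v w
      atMostOne   : ∀ v w → π v w ≤ 1#
      marginal₁   : ∀ v → HasSum (λ w → π v w) (μ₁ v)
      marginal₂   : ∀ w → HasSum (λ v → π v w) (μ₂ w)

  -- WeightedDistance v w r t means d(v,w) · r = t in [0,∞] with t finite, where
  -- ∞ · 0 = 0.  Plans moving mass between components have infinite cost and
  -- so never enter the infimum.
  data WeightedDistance (v w : V) (r t : Carrier) : Set where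
    finite   : ∀ {n} → IsDistance v w n → t ≈ fromℕ n * r → WeightedDistance v w r t
    infinite : (∀ n → ¬ Walk v w n) → r ≈ 0# → t ≈ 0# → WeightedDistance v w r t

  HasCost : (V → V → Carrier) → Carrier → Set
  HasCost π s =
    Σ (V → V → Carrier) λ c → (∀ v w → WeightedDistance v w (π v w) (c v w)) ×
    Σ (V → Carrier) λ rows → (∀ v → HasSum (c v) (rows v)) × HasSum rows s

  W₁ : (V → Carrier) → (V → Carrier) → Carrier
  W₁ μ₁ μ₂ = inf λ s → ∃ λ π → IsTransportPlan μ₁ μ₂ π × HasCost π s

  -- The curvature is only defined for vertices at finite distance.
  κ : ∀ {x y δ} → IsDistance x y δ → Carrier → Carrier
  κ {x} {y} {δ} _ p = 1# - W₁ (μ p x) (μ p y) / fromℕ δ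

{-# OPTIONS --safe #-}
-- Only transport plans are used, no duality.  Let q exceed the claimed bound and
-- take any plan from μ_x^q to μ_y^q.  Unless (x,y) already carries enough mass, some
-- of it goes from x to some z ~ y, and some from some w ~ x to y; let w′ ~ x lie on
-- a geodesic from x to z, and z′ ~ y on one from w to y.  The bound says precisely
-- that the masses moved along (x,y), (w′,y), (x,z′) and (w′,z′) cannot all be
-- negligible.  If one of the last three is not, rerouting towards x → y, w′ → z, w →
-- z′ does not raise the cost, since d(w′,z) < d(x,z), d(w,z′) < d(w,y) and d(x,y)
-- exceeds none of d(w′,y) + 1, d(x,z′) + 1, d(w′,z′) + 2.  So a fixed amount may be
-- assumed to go from x to y directly; withdrawing it and rescaling gives a plan for
-- a smaller laziness p. Hence q ↦ W₁(μ_x^q, μ_y^q) interpolates linearly between p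
-- and 1, and κ is affine near every point above the bound.
module Submission where

open import Algebra.Solver.Ring.AlmostCommutativeRing using (_-Raw-AlmostCommutative⟶_; fromCommutativeRing)
import Algebra.Properties.Ring
import Algebra.Properties.Semiring.Mult as Mult
import Algebra.Properties.Semiring.Mult.TCOptimised as Optimised
import Algebra.Solver.Ring
open import Data.Empty using (⊥-elim)
import Data.Integer as ℤ
import Data.Integer.Properties as ℤ
open import Data.List using (List; []; _∷_; _++_; length; foldr)
open import Data.List.Membership.Propositional using (_∈_; _∉_)
open import Data.List.Membership.Propositional.Properties using (∈-∃++; ∈-++⁺ˡ; ∈-++⁺ʳ; ∈-++⁻)
import Data.List.Relation.Unary.All as All
open import Data.List.Relation.Unary.AllPairs using ([]; _∷_)
open import Data.List.Relation.Unary.Any using (here; there)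
open import Data.List.Relation.Unary.Unique.Propositional using (Unique)
open import Data.Maybe using (Maybe; just; nothing)
open import Data.Nat as ℕ using (ℕ; zero; suc)
import Data.Nat.Properties as ℕ
import Data.Nat.Tactic.RingSolver as ℕ-Solver
open import Data.Product using (Σ; ∃; _×_; _,_; proj₁; proj₂)
import Data.Sign as Sign
open import Data.Sum using (_⊎_; inj₁; inj₂; [_,_]′)
open import Defs
open import Function using (_∘_)
open import Function.Bundles using (Equivalence)
open import Level using (0ℓ)
open import Relation.Binary.Bundles using (StrictTotalOrder)
open import Relation.Binary.Definitions using (tri<; tri≈; tri>)
import Relation.Binary.Properties.StrictTotalOrder
open import Relation.Binary.PropositionalEquality as ≡ using (_≡_; _≢_)
import Relation.Binary.Reasoning.Setoid
import Relation.Binary.Reasoning.StrictPartialOrder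
open import Relation.Nullary using (¬_; Dec; yes; no)
open import Relation.Unary using (Pred)

-- The infimum defining W₁ is never shown to be attained, and this shapes the statements: rerouting
-- must apply to every plan for q, not only to optimal ones, and the amount ε it brings to (x,y)
-- must depend on p and q alone.
--
-- Origin of the bound: put a = (1-q)/d_x and b = (1-q)/d_y. Row w′, column z′ and column y carry
-- the masses a, b and q, but all rows of neighbours of x together carry only 1-q. The surplus a + b
-- + q - (1-q) has to be found in the four cells (x,y), (w′,y), (x,z′), (w′,z′). If 2·d_x·d_y > d_x
-- + d_y and q < 1, it is positive exactly when q exceeds the bound.
--
-- For affinity, p stays fixed slightly to the left of the supposed critical point while q varies:
-- the weights (1-q)/(1-p) and (q-p)/(1-p) are then affine in q and W₁ at p is a constant. One
-- window has to serve all q in it, and the constants of `Neighbourhood` are chosen for that.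

-- Arithmetic in the ordered field of reals.

module RealArithmetic (ℝ : RealNumbers) where
  open RealNumbers ℝ
  open Algebra.Properties.Ring ring using (-0#≈0#; -‿involutive; -‿distribˡ-*; -‿distribʳ-*; -‿+-comm)
  open Mult semiring using (×-homo-+)

  -- The ring solver has to test coefficients for equality, so they are integers mapped into the
  -- reals. With the optimised multiple, `1 ×′ 1#` computes to `1#`, which makes `1-homo` hold by
  -- `refl`.
  module IntegerCoefficients where
    open Optimised semiring using (×1-homo-*) renaming (_×_ to _×′_; 1+× to 1+×′; ×-homo-+ to ×′-homo-+)
    open Relation.Binary.Reasoning.Setoid setoid

    fromℤ : ℤ.ℤ → Carrier
    fromℤ (ℤ.+ n)    = n ×′ 1#
    fromℤ ℤ.-[1+ n ] = - (suc n ×′ 1#)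

    fromℤ-neg : ∀ i → fromℤ (ℤ.- i) ≈ - fromℤ i
    fromℤ-neg (ℤ.+ zero)  = sym -0#≈0#
    fromℤ-neg (ℤ.+ suc n) = refl
    fromℤ-neg ℤ.-[1+ n ]  = sym (-‿involutive _)

    cancel-1 : ∀ a b → (1# + a) - (1# + b) ≈ a - b
    cancel-1 a b = begin
      (1# + a) - (1# + b)     ≈⟨ +-congˡ (-‿+-comm 1# b) ⟨
      (1# + a) + (- 1# - b)   ≈⟨ +-congʳ (+-comm 1# a) ⟩
      (a + 1#) + (- 1# - b)   ≈⟨ +-assoc a 1# _ ⟩
      a + (1# + (- 1# - b))   ≈⟨ +-congˡ (+-assoc 1# _ _) ⟨
      a + ((1# - 1#) - b)     ≈⟨ +-congˡ (+-congʳ (-‿inverseʳ 1#)) ⟩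
      a + (0# - b)            ≈⟨ +-congˡ (+-identityˡ _) ⟩
      a - b                   ∎

    fromℤ-⊖ : ∀ m n → fromℤ (m ℤ.⊖ n) ≈ m ×′ 1# - n ×′ 1#
    fromℤ-⊖ zero    zero    = sym (-‿inverseʳ 0#)
    fromℤ-⊖ zero    (suc n) = sym (+-identityˡ _)
    fromℤ-⊖ (suc m) zero    = sym (trans (+-congˡ -0#≈0#) (+-identityʳ _))
    fromℤ-⊖ (suc m) (suc n) = begin
      fromℤ (suc m ℤ.⊖ suc n)           ≡⟨ ≡.cong fromℤ (ℤ.[1+m]⊖[1+n]≡m⊖n m n) ⟩
      fromℤ (m ℤ.⊖ n)                   ≈⟨ fromℤ-⊖ m n ⟩
      m ×′ 1# - n ×′ 1#                 ≈⟨ cancel-1 _ _ ⟨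
      (1# + m ×′ 1#) - (1# + n ×′ 1#)   ≈⟨ +-cong (1+×′ m 1#) (-‿cong (1+×′ n 1#)) ⟨
      suc m ×′ 1# - suc n ×′ 1#         ∎

    fromℤ-+ : ∀ i j → fromℤ (i ℤ.+ j) ≈ fromℤ i + fromℤ j
    fromℤ-+ (ℤ.+ m)    (ℤ.+ n)    = ×′-homo-+ 1# m n
    fromℤ-+ (ℤ.+ m)    ℤ.-[1+ n ] = fromℤ-⊖ m (suc n)
    fromℤ-+ ℤ.-[1+ m ] (ℤ.+ n)    = trans (fromℤ-⊖ n (suc m)) (+-comm _ _)
    fromℤ-+ ℤ.-[1+ m ] ℤ.-[1+ n ] = begin
      - (suc (suc (m ℕ.+ n)) ×′ 1#)        ≡⟨ ≡.cong (λ k → - (k ×′ 1#)) (≡.cong suc (ℕ.+-suc m n)) ⟨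
      - ((suc m ℕ.+ suc n) ×′ 1#)          ≈⟨ -‿cong (×′-homo-+ 1# (suc m) (suc n)) ⟩
      - (suc m ×′ 1# + suc n ×′ 1#)        ≈⟨ -‿+-comm _ _ ⟨
      - (suc m ×′ 1#) - suc n ×′ 1#        ∎

    fromℤ-◃⁺ : ∀ n → fromℤ (Sign.+ ℤ.◃ n) ≈ n ×′ 1#
    fromℤ-◃⁺ zero    = refl
    fromℤ-◃⁺ (suc n) = refl

    fromℤ-◃⁻ : ∀ n → fromℤ (Sign.- ℤ.◃ n) ≈ - (n ×′ 1#)
    fromℤ-◃⁻ zero    = sym -0#≈0#
    fromℤ-◃⁻ (suc n) = refl

    fromℤ-* : ∀ i j → fromℤ (i ℤ.* j) ≈ fromℤ i * fromℤ j
    fromℤ-* (ℤ.+ m) (ℤ.+ n) = trans (fromℤ-◃⁺ (m ℕ.* n)) (×1-homo-* m n)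
    fromℤ-* (ℤ.+ m) ℤ.-[1+ n ] = begin
      fromℤ (Sign.- ℤ.◃ (m ℕ.* suc n))   ≈⟨ fromℤ-◃⁻ (m ℕ.* suc n) ⟩
      - ((m ℕ.* suc n) ×′ 1#)            ≈⟨ -‿cong (×1-homo-* m (suc n)) ⟩
      - (m ×′ 1# * suc n ×′ 1#)          ≈⟨ -‿distribʳ-* _ _ ⟩
      m ×′ 1# * - (suc n ×′ 1#)          ∎
    fromℤ-* ℤ.-[1+ m ] (ℤ.+ n) = begin
      fromℤ (Sign.- ℤ.◃ (suc m ℕ.* n))   ≈⟨ fromℤ-◃⁻ (suc m ℕ.* n) ⟩
      - ((suc m ℕ.* n) ×′ 1#)            ≈⟨ -‿cong (×1-homo-* (suc m) n) ⟩
      - (suc m ×′ 1# * n ×′ 1#)          ≈⟨ -‿distribˡ-* _ _ ⟩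
      - (suc m ×′ 1#) * n ×′ 1#          ∎
    fromℤ-* ℤ.-[1+ m ] ℤ.-[1+ n ] = begin
      (suc m ℕ.* suc n) ×′ 1#            ≈⟨ ×1-homo-* (suc m) (suc n) ⟩
      suc m ×′ 1# * suc n ×′ 1#          ≈⟨ -‿involutive _ ⟨
      - - (suc m ×′ 1# * suc n ×′ 1#)    ≈⟨ -‿cong (-‿distribˡ-* _ _) ⟩
      - (- (suc m ×′ 1#) * suc n ×′ 1#)  ≈⟨ -‿distribʳ-* _ _ ⟩
      - (suc m ×′ 1#) * - (suc n ×′ 1#)  ∎

    homomorphism : ℤ.+-*-rawRing -Raw-AlmostCommutative⟶ fromCommutativeRing commutativeRing
    homomorphism = record
      { ⟦_⟧ = fromℤ ; +-homo = fromℤ-+ ; *-homo = fromℤ-* ; -‿homo = fromℤ-neg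
      ; 0-homo = refl ; 1-homo = refl }

    ≈? : ∀ i j → Maybe (fromℤ i ≈ fromℤ j)
    ≈? i j with i ℤ.≟ j
    ... | yes i≡j = just (reflexive (≡.cong fromℤ i≡j))
    ... | no _    = nothing

  open Algebra.Solver.Ring ℤ.+-*-rawRing (fromCommutativeRing commutativeRing)
    IntegerCoefficients.homomorphism IntegerCoefficients.≈? public
    using (solve; _:=_; _:+_; _:*_; _:-_; :-_; con; Polynomial)

  -- Numerals in solver calls are spelled `:1 :+ (:1 :+ :0)` because `fromℕ 2` unfolds to exactly
  -- this sum.
  :0 :1 : ∀ {n} → Polynomial n
  :0 = con (ℤ.+ 0)
  :1 = con (ℤ.+ 1)

  strictTotalOrder : StrictTotalOrder _ _ _
  strictTotalOrder = record { isStrictTotalOrder = isStrictTotalOrder }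

  open StrictTotalOrder strictTotalOrder public
    using (compare; strictPartialOrder; <-respˡ-≈; <-respʳ-≈; irrefl)
    renaming (trans to <-trans)
  open Relation.Binary.Properties.StrictTotalOrder strictTotalOrder public
    using (≤-respˡ-≈; ≤-respʳ-≈; antisym)
    renaming (trans to ≤-trans; reflexive to ≤-reflexive; refl to ≤-refl)
  module ≤-Reasoning = Relation.Binary.Reasoning.StrictPartialOrder strictPartialOrder
  open ≤-Reasoning

  abstract
    <⇒≤ : ∀ {x y} → x < y → x ≤ y
    <⇒≤ = inj₁

    <-≤-trans : ∀ {x y z} → x < y → y ≤ z → x < z
    <-≤-trans x<y (inj₁ y<z) = <-trans x<y y<z
    <-≤-trans x<y (inj₂ y≈z) = <-respʳ-≈ y≈z x<y

    ≤-<-trans : ∀ {x y z} → x ≤ y → y < z → x < z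
    ≤-<-trans (inj₁ x<y) y<z = <-trans x<y y<z
    ≤-<-trans (inj₂ x≈y) y<z = <-respˡ-≈ (sym x≈y) y<z

    ≤⇒≯ : ∀ {x y} → x ≤ y → ¬ y < x
    ≤⇒≯ x≤y y<x = irrefl refl (≤-<-trans x≤y y<x)

    ≤-or-> : ∀ x y → x ≤ y ⊎ y < x
    ≤-or-> x y with compare x y
    ... | tri< x<y _ _ = inj₁ (inj₁ x<y)
    ... | tri≈ _ x≈y _ = inj₁ (inj₂ x≈y)
    ... | tri> _ _ y<x = inj₂ y<x

    ≮⇒≥ : ∀ {x y} → ¬ x < y → y ≤ x
    ≮⇒≥ {x} {y} x≮y = [ (λ y≤x → y≤x) , (λ x<y → ⊥-elim (x≮y x<y)) ]′ (≤-or-> y x)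

    +-mono-<-≤ : ∀ {x y u v} → x < y → u ≤ v → x + u < y + v
    +-mono-<-≤ {x} {y} {u} {v} x<y u≤v = <-≤-trans (+-monoˡ-< u x<y) (step u≤v)
      where
      step : u ≤ v → y + u ≤ y + v
      step (inj₁ u<v) = inj₁ (<-respˡ-≈ (+-comm u y) (<-respʳ-≈ (+-comm v y) (+-monoˡ-< y u<v)))
      step (inj₂ u≈v) = inj₂ (+-congˡ u≈v)

    +-mono-≤ : ∀ {x y u v} → x ≤ y → u ≤ v → x + u ≤ y + v
    +-mono-≤ (inj₁ x<y) u≤v = inj₁ (+-mono-<-≤ x<y u≤v)
    +-mono-≤ {x} {y} {u} {v} (inj₂ x≈y) (inj₁ u<v) =
      inj₁ (<-respˡ-≈ (+-comm u x) (<-respʳ-≈ (+-comm v y) (+-mono-<-≤ u<v (inj₂ x≈y))))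
    +-mono-≤ (inj₂ x≈y) (inj₂ u≈v) = inj₂ (+-cong x≈y u≈v)

    +-nonNeg : ∀ {x y} → 0# ≤ x → 0# ≤ y → 0# ≤ x + y
    +-nonNeg 0≤x 0≤y = ≤-respˡ-≈ (+-identityˡ 0#) (+-mono-≤ 0≤x 0≤y)

    +-pos-nonNeg : ∀ {x y} → 0# < x → 0# ≤ y → 0# < x + y
    +-pos-nonNeg 0<x 0≤y = <-respˡ-≈ (+-identityˡ 0#) (+-mono-<-≤ 0<x 0≤y)

    *-nonNeg : ∀ {x y} → 0# ≤ x → 0# ≤ y → 0# ≤ x * y
    *-nonNeg (inj₁ 0<x) (inj₁ 0<y) = inj₁ (*-pos 0<x 0<y)
    *-nonNeg (inj₁ _)   (inj₂ 0≈y) = inj₂ (sym (trans (*-congˡ (sym 0≈y)) (zeroʳ _)))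
    *-nonNeg (inj₂ 0≈x) _          = inj₂ (sym (trans (*-congʳ (sym 0≈x)) (zeroˡ _)))

    -- Inequalities are proved by exhibiting the difference of the two sides
    -- as a combination of quantities of known sign.
    ≤-difference : ∀ {x y e} → 0# ≤ e → e ≈ y - x → x ≤ y
    ≤-difference {x} {y} {e} 0≤e e≈y-x = begin
      x            ≈⟨ +-identityˡ x ⟨
      0# + x       ≤⟨ +-mono-≤ 0≤e ≤-refl ⟩
      e + x        ≈⟨ +-congʳ e≈y-x ⟩
      (y - x) + x  ≈⟨ solve 2 (λ x y → (y :- x) :+ x := y) refl x y ⟩
      y            ∎

    <-difference : ∀ {x y e} → 0# < e → e ≈ y - x → x < y
    <-difference {x} {y} {e} 0<e e≈y-x = begin-strict
      x            ≈⟨ +-identityˡ x ⟨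
      0# + x       <⟨ +-monoˡ-< x 0<e ⟩
      e + x        ≈⟨ +-congʳ e≈y-x ⟩
      (y - x) + x  ≈⟨ solve 2 (λ x y → (y :- x) :+ x := y) refl x y ⟩
      y            ∎

    difference-nonNeg : ∀ {x y} → x ≤ y → 0# ≤ y - x
    difference-nonNeg {x} x≤y = ≤-respˡ-≈ (-‿inverseʳ x) (+-mono-≤ x≤y ≤-refl)

    difference-pos : ∀ {x y} → x < y → 0# < y - x
    difference-pos {x} x<y = <-respˡ-≈ (-‿inverseʳ x) (+-monoˡ-< (- x) x<y)

    *-monoˡ-≤ : ∀ {z x y} → 0# ≤ z → x ≤ y → z * x ≤ z * y
    *-monoˡ-≤ {z} {x} {y} 0≤z x≤y = ≤-difference (*-nonNeg 0≤z (difference-nonNeg x≤y))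
      (solve 3 (λ x y z → z :* (y :- x) := z :* y :- z :* x) refl x y z)

    *-monoˡ-< : ∀ {z x y} → 0# < z → x < y → z * x < z * y
    *-monoˡ-< {z} {x} {y} 0<z x<y = <-difference (*-pos 0<z (difference-pos x<y))
      (solve 3 (λ x y z → z :* (y :- x) := z :* y :- z :* x) refl x y z)

    *-cancelˡ-< : ∀ {z x y} → 0# ≤ z → z * x < z * y → x < y
    *-cancelˡ-< 0≤z zx<zy = [ (λ y≤x → ⊥-elim (≤⇒≯ (*-monoˡ-≤ 0≤z y≤x) zx<zy)) , (λ x<y → x<y) ]′ (≤-or-> _ _)

    *-cancelˡ-≤ : ∀ {z x y} → 0# < z → z * x ≤ z * y → x ≤ y
    *-cancelˡ-≤ 0<z zx≤zy = ≮⇒≥ λ y<x → ≤⇒≯ zx≤zy (*-monoˡ-< 0<z y<x)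

    pos⇒≉0 : ∀ {x} → 0# < x → ¬ x ≈ 0#
    pos⇒≉0 0<x x≈0 = irrefl (sym x≈0) 0<x

    ⁻¹-pos : ∀ {x} → 0# < x → 0# < x ⁻¹
    ⁻¹-pos {x} 0<x = *-cancelˡ-< (<⇒≤ 0<x)
      (<-respˡ-≈ (sym (zeroʳ x)) (<-respʳ-≈ (sym (*-inverseʳ (pos⇒≉0 0<x))) 0<1))

    /-*-cancel : ∀ {x y} → ¬ y ≈ 0# → y * (x / y) ≈ x
    /-*-cancel {x} {y} y≉0 =
      trans (solve 3 (λ x y z → y :* (x :* z) := x :* (y :* z)) refl x y (y ⁻¹))
      (trans (*-congˡ (*-inverseʳ y≉0)) (*-identityʳ x))

    /-unique : ∀ {x y z} → ¬ y ≈ 0# → x ≈ z * y → x / y ≈ z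
    /-unique {x} {y} {z} y≉0 x≈zy = trans (*-congʳ x≈zy) (trans (*-assoc _ _ _) (trans (*-congˡ (*-inverseʳ y≉0)) (*-identityʳ z)))

    fromℕ-+ : ∀ m n → fromℕ (m ℕ.+ n) ≈ fromℕ m + fromℕ n
    fromℕ-+ = ×-homo-+ 1#

    fromℕ-nonNeg : ∀ n → 0# ≤ fromℕ n
    fromℕ-nonNeg zero    = ≤-refl
    fromℕ-nonNeg (suc n) = +-nonNeg (<⇒≤ 0<1) (fromℕ-nonNeg n)

    fromℕ-pos : ∀ n → 0# < fromℕ (suc n)
    fromℕ-pos n = +-pos-nonNeg 0<1 (fromℕ-nonNeg n)

    fromℕ-mono : ∀ {m n} → m ℕ.≤ n → fromℕ m ≤ fromℕ n
    fromℕ-mono {n = n} ℕ.z≤n = fromℕ-nonNeg n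
    fromℕ-mono (ℕ.s≤s m≤n)   = +-mono-≤ ≤-refl (fromℕ-mono m≤n)

    1≤fromℕ : ∀ {n} → 1 ℕ.≤ n → 1# ≤ fromℕ n
    1≤fromℕ 1≤n = ≤-respˡ-≈ (+-identityʳ 1#) (fromℕ-mono 1≤n)

    1≤⇒fromℕ-pos : ∀ {n} → 1 ℕ.≤ n → 0# < fromℕ n
    1≤⇒fromℕ-pos 1≤n = <-≤-trans 0<1 (1≤fromℕ 1≤n)

    fromℕ-mono-+ : ∀ i j k l → i ℕ.+ j ℕ.≤ k ℕ.+ l → fromℕ i + fromℕ j ≤ fromℕ k + fromℕ l
    fromℕ-mono-+ i j k l le = ≤-respˡ-≈ (fromℕ-+ i j) (≤-respʳ-≈ (fromℕ-+ k l) (fromℕ-mono le))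

    small-multiple : ∀ n {a} → 0# < a → ∃ λ e → 0# < e × fromℕ n * e ≤ a
    -- Dividing by `suc n` keeps the divisor positive when `n` is zero.
    small-multiple n {a} 0<a = a / fromℕ (suc n) , *-pos 0<a (⁻¹-pos (fromℕ-pos n)) , (begin
      fromℕ n * e                ≤⟨ ≤-difference (<⇒≤ (*-pos 0<a (⁻¹-pos (fromℕ-pos n))))
                                     (solve 2 (λ m e → e := (:1 :+ m) :* e :- m :* e) refl (fromℕ n) e) ⟩
      fromℕ (suc n) * e          ≈⟨ /-*-cancel (pos⇒≉0 (fromℕ-pos n)) ⟩
      a                          ∎)
      where
      e : Carrier
      e = a / fromℕ (suc n)

    lower-bound : ∀ {a b} → 0# < a → 0# < b → ∃ λ e → 0# < e × e ≤ a × e ≤ b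
    lower-bound {a} {b} 0<a 0<b =
      [ (λ a≤b → a , 0<a , ≤-refl , a≤b) , (λ b<a → b , 0<b , <⇒≤ b<a , ≤-refl) ]′ (≤-or-> a b)

    ∣-∣<-intro : ∀ {r e} → - e < r → r < e → ∣ r ∣ < e
    ∣-∣<-intro {r} {e} -e<r r<e with compare r 0#
    ... | tri< _ _ _ = <-difference (difference-pos -e<r) (solve 2 (λ r e → r :- (:- e) := e :- (:- r)) refl r e)
    ... | tri≈ _ _ _ = r<e
    ... | tri> _ _ _ = r<e

    ∣-∣<-elim : ∀ {r e} → ∣ r ∣ < e → - e < r × r < e
    ∣-∣<-elim {r} {e} ∣r∣<e with compare r 0#
    ... | tri< r<0 _ _ =
      <-difference (difference-pos ∣r∣<e) (solve 2 (λ r e → e :- (:- r) := r :- (:- e)) refl r e) ,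
      <-trans (<-trans r<0 (difference-pos-neg r<0)) ∣r∣<e
      where
      difference-pos-neg : ∀ {r} → r < 0# → 0# < - r
      difference-pos-neg r<0 = <-respʳ-≈ (+-identityˡ _) (difference-pos r<0)
    ... | tri≈ _ r≈0 _ = neg-bound (inj₂ (sym r≈0)) , ∣r∣<e
      where
      neg-bound : 0# ≤ r → - e < r
      neg-bound 0≤r = <-difference (+-pos-nonNeg (≤-<-trans 0≤r ∣r∣<e) 0≤r) (solve 2 (λ r e → e :+ r := r :- (:- e)) refl r e)
    ... | tri> _ _ 0<r = neg-bound (inj₁ 0<r) , ∣r∣<e
      where
      neg-bound : 0# ≤ r → - e < r
      neg-bound 0≤r = <-difference (+-pos-nonNeg (≤-<-trans 0≤r ∣r∣<e) 0≤r) (solve 2 (λ r e → e :+ r := r :- (:- e)) refl r e)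

    ≤-limit : ∀ {x y} → (∀ e → 0# < e → x < y + e) → x ≤ y
    ≤-limit {x} {y} close = ≮⇒≥ λ y<x → irrefl refl (<-respʳ-≈
      (solve 2 (λ x y → y :+ (x :- y) := x) refl x y) (close (x - y) (difference-pos y<x)))

    ≈-limit : ∀ {x y} → (∀ e → 0# < e → ∣ x - y ∣ < e) → x ≈ y
    ≈-limit {x} {y} close = antisym
      (≤-limit λ e 0<e → <-difference (difference-pos (proj₂ (∣-∣<-elim (close e 0<e))))
        (solve 3 (λ x y e → e :- (x :- y) := (y :+ e) :- x) refl x y e))
      (≤-limit λ e 0<e → <-difference (difference-pos (proj₁ (∣-∣<-elim (close e 0<e))))
        (solve 3 (λ x y e → (x :- y) :- (:- e) := (x :+ e) :- y) refl x y e))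

-- A function that is affine on an open interval has no critical point there.

module AffineFunctions (ℝ : RealNumbers) where
  open RealNumbers ℝ
  open RealArithmetic ℝ

  abstract
    strict-lower-bound : ∀ {a b} → 0# < a → 0# < b → ∃ λ e → 0# < e × e < a × e < b
    strict-lower-bound 0<a 0<b with lower-bound 0<a 0<b
    ... | m , 0<m , m≤a , m≤b with small-multiple 2 0<m
    ...   | e , 0<e , 2e≤m = e , 0<e , <-≤-trans e<m m≤a , <-≤-trans e<m m≤b
      where
      e<m : e < m
      e<m = <-≤-trans (<-difference 0<e (solve 1 (λ e → e := (:1 :+ (:1 :+ :0)) :* e :- e) refl e)) 2e≤m

    -- One sample point within each radius suffices: `HasLimit` itself supplies a value of the
    -- partial function there, and that value can only be `σ`.
    limit-unique : ∀ {D F p L σ} →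
      (∀ η → 0# < η → ∃ λ q → D q × ∣ q - p ∣ < η × (∀ m → F q m → m ≈ σ)) →
      HasLimit D F p L → σ ≈ L
    limit-unique {L = L} {σ} sample limit = ≈-limit close
      where
      close : ∀ e → 0# < e → ∣ σ - L ∣ < e
      close e 0<e with limit e 0<e
      ... | η , 0<η , near with sample η 0<η
      ... | q , Dq , q≈p , constant with near q Dq q≈p
      ...   | m , Fqm , ∣m-L∣<e with ∣-∣<-elim ∣m-L∣<e
      ...     | lower , upper = ∣-∣<-intro (<-respʳ-≈ m-L≈σ-L lower) (<-respˡ-≈ m-L≈σ-L upper)
        where
        m-L≈σ-L : m - L ≈ σ - L
        m-L≈σ-L = +-congʳ (constant m Fqm)

    module _ {f : Carrier → Carrier} {p₁ p₂ σ β : Carrier}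
             (affine : ∀ q → p₁ < q → q < p₂ → f q ≈ σ * q + β) where

      right-sample : ∀ {p} → p < p₂ → ∀ η → 0# < η → ∃ λ q → p < q × q < p₂ × ∣ q - p ∣ < η
      right-sample {p} p<p₂ η 0<η with strict-lower-bound 0<η (difference-pos p<p₂)
      ... | s , 0<s , s<η , s<p₂-p =
        p + s ,
        <-difference 0<s (solve 2 (λ p s → s := (p :+ s) :- p) refl p s) ,
        <-difference (difference-pos s<p₂-p) (solve 3 (λ p s t → (t :- p) :- s := t :- (p :+ s)) refl p s p₂) ,
        ∣-∣<-intro
          (<-difference (+-pos-nonNeg 0<s (<⇒≤ 0<η)) (solve 3 (λ p s η → s :+ η := ((p :+ s) :- p) :- (:- η)) refl p s η))
          (<-difference (difference-pos s<η) (solve 3 (λ p s η → η :- s := η :- ((p :+ s) :- p)) refl p s η))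

      left-sample : ∀ {p} → p₁ < p → ∀ η → 0# < η → ∃ λ q → q < p × p₁ < q × ∣ q - p ∣ < η
      left-sample {p} p₁<p η 0<η with strict-lower-bound 0<η (difference-pos p₁<p)
      ... | s , 0<s , s<η , s<p-p₁ =
        p - s ,
        <-difference 0<s (solve 2 (λ p s → s := p :- (p :- s)) refl p s) ,
        <-difference (difference-pos s<p-p₁) (solve 3 (λ p s t → (p :- t) :- s := (p :- s) :- t) refl p s p₁) ,
        ∣-∣<-intro
          (<-difference (difference-pos s<η) (solve 3 (λ p s η → η :- s := ((p :- s) :- p) :- (:- η)) refl p s η))
          (<-difference (+-pos-nonNeg 0<s (<⇒≤ 0<η)) (solve 3 (λ p s η → s :+ η := η :- ((p :- s) :- p)) refl p s η))

      -- Difference quotients taken slightly to the right of `p` are exactly `σ`, so they pin down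
      -- the two-sided limit.
      derivative-unique : ∀ {p m} → p₁ < p → p < p₂ → HasDerivative f p m → m ≈ σ
      derivative-unique {p} {m} p₁<p p<p₂ deriv = sym (limit-unique sample deriv)
        where
        sample : ∀ η → 0# < η → ∃ λ q → ¬ q ≈ p × ∣ q - p ∣ < η × (∀ m → m ≈ (f q - f p) / (q - p) → m ≈ σ)
        sample η 0<η =
          let q , p<q , q<p₂ , close = right-sample p<p₂ η 0<η
          in q , (λ q≈p → irrefl (sym q≈p) p<q) , close ,
          λ _ m≈ → trans m≈ (/-unique (pos⇒≉0 (difference-pos p<q)) (trans
            (+-cong (affine q (<-trans p₁<p p<q) q<p₂) (-‿cong (affine p p₁<p p<p₂)))
            (solve 4 (λ σ β p q → (σ :* q :+ β) :- (σ :* p :+ β) := σ :* (q :- p)) refl σ β p q)))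

      affine⇒¬critical : ∀ {p} → p₁ < p → p < p₂ → ¬ IsCriticalPoint f p
      affine⇒¬critical {p} p₁<p p<p₂ (_ , _ , L , R , left , right , L≉R) =
        L≉R (trans (sym (limit-unique left′ left)) (limit-unique right′ right))
        where
        left′ : ∀ η → 0# < η → ∃ λ q → q < p × ∣ q - p ∣ < η × (∀ m → HasDerivative f q m → m ≈ σ)
        left′ η 0<η =
          let q , q<p , p₁<q , close = left-sample p₁<p η 0<η
          in q , q<p , close , λ _ → derivative-unique p₁<q (<-trans q<p p<p₂)

        right′ : ∀ η → 0# < η → ∃ λ q → p < q × ∣ q - p ∣ < η × (∀ m → HasDerivative f q m → m ≈ σ)
        right′ η 0<η =
          let q , p<q , q<p₂ , close = right-sample p<p₂ η 0<η
          in q , p<q , close , λ _ → derivative-unique (<-trans p₁<p p<q) q<p₂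

-- Finite sums, and `HasSum` for families of finite support.

module FiniteSums (ℝ : RealNumbers) {A : Set} where
  open RealNumbers ℝ
  open RealArithmetic ℝ

  ∑ : List A → (A → Carrier) → Carrier
  ∑ L f = foldr (λ i t → f i + t) 0# L

  abstract
    ∑-cong : ∀ {f g} L → (∀ {i} → i ∈ L → f i ≈ g i) → ∑ L f ≈ ∑ L g
    ∑-cong []      f≈g = refl
    ∑-cong (i ∷ L) f≈g = +-cong (f≈g (here ≡.refl)) (∑-cong L (f≈g ∘ there))

    ∑-zero : ∀ {f} L → (∀ {i} → i ∈ L → f i ≈ 0#) → ∑ L f ≈ 0#
    ∑-zero []      f≈0 = refl
    ∑-zero (i ∷ L) f≈0 = trans (+-cong (f≈0 (here ≡.refl)) (∑-zero L (f≈0 ∘ there))) (+-identityˡ 0#)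

    ∑-const : ∀ L k → ∑ L (λ _ → k) ≈ fromℕ (length L) * k
    ∑-const []      k = sym (zeroˡ k)
    ∑-const (i ∷ L) k = trans (+-congˡ (∑-const L k)) (solve 2 (λ k n → k :+ n :* k := (:1 :+ n) :* k) refl k (fromℕ (length L)))

    ∑-+ : ∀ L f g → ∑ L (λ i → f i + g i) ≈ ∑ L f + ∑ L g
    ∑-+ []      f g = sym (+-identityˡ 0#)
    ∑-+ (i ∷ L) f g = trans (+-congˡ (∑-+ L f g))
      (solve 4 (λ a b c d → (a :+ b) :+ (c :+ d) := (a :+ c) :+ (b :+ d)) refl (f i) (g i) (∑ L f) (∑ L g))

    ∑-*ˡ : ∀ L k f → ∑ L (λ i → k * f i) ≈ k * ∑ L f
    ∑-*ˡ []      k f = sym (zeroʳ k)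
    ∑-*ˡ (i ∷ L) k f = trans (+-congˡ (∑-*ˡ L k f)) (sym (distribˡ k (f i) (∑ L f)))

    ∑-nonNeg : ∀ {f} L → (∀ {i} → i ∈ L → 0# ≤ f i) → 0# ≤ ∑ L f
    ∑-nonNeg []      0≤f = ≤-refl
    ∑-nonNeg (i ∷ L) 0≤f = +-nonNeg (0≤f (here ≡.refl)) (∑-nonNeg L (0≤f ∘ there))

    term≤∑ : ∀ {f} L → (∀ {i} → i ∈ L → 0# ≤ f i) → ∀ {i} → i ∈ L → f i ≤ ∑ L f
    term≤∑ {f} (i ∷ L) 0≤f (here ≡.refl) = ≤-difference (∑-nonNeg L (0≤f ∘ there))
      (solve 2 (λ a s → s := (a :+ s) :- a) refl (f i) (∑ L f))
    term≤∑ {f} (i ∷ L) 0≤f (there j∈L) = ≤-trans (term≤∑ L (0≤f ∘ there) j∈L)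
      (≤-difference (0≤f (here ≡.refl)) (solve 2 (λ a s → a := (a :+ s) :- s) refl (f i) (∑ L f)))

    -- Pigeonhole: terms that are all below `t` cannot add up to more than `length L` times `t`.
    ∑-large-term : ∀ {f t} L → fromℕ (length L) * t < ∑ L f → ∃ λ i → i ∈ L × t ≤ f i
    ∑-large-term {t = t} [] 0t<0 = ⊥-elim (irrefl (zeroˡ t) 0t<0)
    ∑-large-term {f} {t} (i ∷ L) large with ≤-or-> t (f i)
    ... | inj₁ t≤fi = i , here ≡.refl , t≤fi
    ... | inj₂ fi<t =
        let j , j∈L , t≤fj = ∑-large-term L (<-difference
                (+-pos-nonNeg (difference-pos large) (<⇒≤ (difference-pos fi<t)))
                (solve 4 (λ n t a s → ((a :+ s) :- (:1 :+ n) :* t) :+ (t :- a) := s :- n :* t) refl (fromℕ (length L)) t (f i) (∑ L f)))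
        in j , there j∈L , t≤fj

    indicator : A → A → Carrier
    indicator a i with excluded-middle (i ≡ a)
    ... | yes _ = 1#
    ... | no  _ = 0#

    indicator-self : ∀ a → indicator a a ≈ 1#
    indicator-self a with excluded-middle (a ≡ a)
    ... | yes _  = refl
    ... | no a≢a = ⊥-elim (a≢a ≡.refl)

    indicator-≢ : ∀ {a i} → i ≢ a → indicator a i ≈ 0#
    indicator-≢ {a} {i} i≢a with excluded-middle (i ≡ a)
    ... | yes i≡a = ⊥-elim (i≢a i≡a)
    ... | no _    = refl

    indicator-nonNeg : ∀ a i → 0# ≤ indicator a i
    indicator-nonNeg a i with excluded-middle (i ≡ a)
    ... | yes _ = <⇒≤ 0<1
    ... | no  _ = ≤-refl

    ∑-indicator : ∀ {L a} → Unique L → a ∈ L → ∀ (f : A → Carrier) → ∑ L (λ i → f i * indicator a i) ≈ f a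
    ∑-indicator {i ∷ L} (i∉L ∷ _) (here ≡.refl) f = trans
      (+-cong (trans (*-congˡ (indicator-self i)) (*-identityʳ (f i)))
        (∑-zero L λ {j} j∈L → trans (*-congˡ (indicator-≢ (All.lookup i∉L j∈L ∘ ≡.sym))) (zeroʳ (f j))))
      (+-identityʳ (f i))
    ∑-indicator {i ∷ L} (i∉L ∷ L!) (there a∈L) f = trans
      (+-cong (trans (*-congˡ (indicator-≢ (All.lookup i∉L a∈L))) (zeroʳ (f i))) (∑-indicator L! a∈L f))
      (+-identityˡ _)

    ∑-++ : ∀ L M f → ∑ (L ++ M) f ≈ ∑ L f + ∑ M f
    ∑-++ []      M f = sym (+-identityˡ _)
    ∑-++ (i ∷ L) M f = trans (+-congˡ (∑-++ L M f)) (sym (+-assoc _ _ _))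

    -- Every element of `M` found in `L` is matched and deleted from `L`; as `M` has no repetitions
    -- it is not asked for again. What is left of `L` in the end has a nonnegative sum.
    ∑-support-≤ : ∀ {f} → (∀ i → 0# ≤ f i) → ∀ {M} → Unique M → ∀ L →
                  (∀ {i} → i ∈ M → i ∉ L → f i ≈ 0#) → ∑ M f ≤ ∑ L f
    ∑-support-≤ 0≤f [] L vanish = ∑-nonNeg L λ {i} _ → 0≤f i
    ∑-support-≤ {f} 0≤f {i ∷ M} (i∉M ∷ M!) L vanish with excluded-middle (i ∈ L)
    ... | no i∉L = ≤-respˡ-≈ (sym (trans (+-congʳ (vanish (here ≡.refl) i∉L)) (+-identityˡ _)))
                     (∑-support-≤ 0≤f M! L (vanish ∘ there))
    ... | yes i∈L with ∈-∃++ i∈L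
    ...   | ys , zs , ≡.refl = ≤-respʳ-≈ (sym sum≈) (+-mono-≤ ≤-refl (∑-support-≤ 0≤f M! (ys ++ zs) vanish′))
      where
      sum≈ : ∑ (ys ++ i ∷ zs) f ≈ f i + ∑ (ys ++ zs) f
      sum≈ = trans (∑-++ ys (i ∷ zs) f) (trans
        (solve 3 (λ a b c → b :+ (a :+ c) := a :+ (b :+ c)) refl (f i) (∑ ys f) (∑ zs f))
        (+-congˡ (sym (∑-++ ys zs f))))

      vanish′ : ∀ {j} → j ∈ M → j ∉ ys ++ zs → f j ≈ 0#
      vanish′ {j} j∈M j∉ = vanish (there j∈M) λ j∈ → [ j∉ ∘ ∈-++⁺ˡ , split ]′ (∈-++⁻ ys j∈)
        where
        split : ¬ j ∈ i ∷ zs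
        split (here ≡.refl) = All.lookup i∉M j∈M ≡.refl
        split (there j∈zs)  = j∉ (∈-++⁺ʳ ys j∈zs)

    IsSup-unique : ∀ {S s t} → IsSup S s → IsSup S t → s ≈ t
    IsSup-unique {S} sup-s sup-t = antisym (≮⇒≥ (not-below sup-t sup-s)) (≮⇒≥ (not-below sup-s sup-t))
      where
      not-below : ∀ {s t} → IsSup S s → IsSup S t → ¬ s < t
      not-below {s = s} (upper , _) (_ , least) s<t with least s s<t
      ... | r , Sr , s<r = ≤⇒≯ (upper r Sr) s<r

    -- The list `L` is itself one of the finite subsets competing in the supremum, and none beats
    -- it, so the supremum is attained.
    hasSum-∑ : ∀ {f} → (∀ i → 0# ≤ f i) → ∀ {L} → Unique L → (∀ {i} → i ∉ L → f i ≈ 0#) → HasSum f (∑ L f)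
    hasSum-∑ {f} 0≤f {L} L! vanish =
      (λ { r (is , is! , r≈) → ≤-respˡ-≈ (sym r≈) (∑-support-≤ 0≤f is! L λ _ → vanish) }) ,
      λ z z<∑ → ∑ L f , (L , L! , refl) , z<∑

    hasSum⇒≈∑ : ∀ {f s} → (∀ i → 0# ≤ f i) → ∀ {L} → Unique L → (∀ {i} → i ∉ L → f i ≈ 0#) → HasSum f s → s ≈ ∑ L f
    hasSum⇒≈∑ {f} 0≤f L! vanish hasSum = IsSup-unique {S = λ r → Σ (List A) λ is → Unique is × r ≈ ∑ is f} hasSum (hasSum-∑ 0≤f L! vanish)

    hasSum⇒term≤ : ∀ {f : A → Carrier} {s} → HasSum f s → ∀ i → f i ≤ s
    hasSum⇒term≤ {f} (upper , _) i = upper (f i) (i ∷ [] , All.[] ∷ [] , sym (+-identityʳ (f i)))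

    hasSum-resp-≈ : ∀ {f : A → Carrier} {s t} → s ≈ t → HasSum f s → HasSum f t
    hasSum-resp-≈ s≈t (upper , least) =
      (λ r Sr → ≤-respʳ-≈ s≈t (upper r Sr)) , λ z z<t → least z (<-respʳ-≈ (sym s≈t) z<t)

-- Infima of nonempty sets bounded below.

module Infima (ℝ : RealNumbers) where
  open RealNumbers ℝ
  open RealArithmetic ℝ

  IsInf : Pred Carrier 0ℓ → Carrier → Set
  IsInf S s = (∀ r → S r → s ≤ r) × (∀ z → s < z → ∃ λ r → S r × r < z)

  abstract
    sup-isSup : ∀ {S} → ∃ S → ∃ (IsUpperBound S) → IsSup S (sup S)
    sup-isSup {S} inhabited bounded with excluded-middle (∃ S × ∃ (IsUpperBound S))
    ... | yes (inhabited′ , bounded′) = proj₂ (complete S inhabited′ bounded′)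
    ... | no ¬both                    = ⊥-elim (¬both (inhabited , bounded))

    -- A member of `S` and a lower bound keep the supremum of the negatives away from its junk
    -- value.
    inf-isInf : ∀ {S l} → ∃ S → (∀ r → S r → l ≤ r) → IsInf S (inf S)
    inf-isInf {S} {l} (r₀ , Sr₀) lower with sup-isSup {λ r → ∃ λ s → S s × r ≈ - s}
      (- r₀ , r₀ , Sr₀ , refl) (- l , λ { r (s , Ss , r≈-s) → neg-≤ (lower s Ss) r≈-s })
      where
      neg-≤ : ∀ {r s} → l ≤ s → r ≈ - s → r ≤ - l
      neg-≤ {r} {s} l≤s r≈-s = ≤-respˡ-≈ (sym r≈-s) (≤-difference (difference-nonNeg l≤s)
        (solve 2 (λ l s → s :- l := (:- l) :- (:- s)) refl l s))
    ... | upper , least =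
      (λ r Sr → ≤-difference (difference-nonNeg (upper (- r) (r , Sr , refl)))
        (solve 2 (λ r u → u :- (:- r) := r :- (:- u)) refl r u)) ,
      λ z -u<z → approximate z (least (- z) (<-difference (difference-pos -u<z)
        (solve 2 (λ z u → z :- (:- u) := u :- (:- z)) refl z u)))
      where
      u : Carrier
      u = sup λ r → ∃ λ s → S s × r ≈ - s
      approximate : ∀ z → (∃ λ r → (∃ λ s → S s × r ≈ - s) × - z < r) → ∃ λ r → S r × r < z
      approximate z (r , (s , Ss , r≈-s) , -z<r) = s , Ss , <-difference (difference-pos -z<r)
        (trans (+-congʳ r≈-s) (solve 2 (λ s z → (:- s) :- (:- z) := z :- s) refl s z))

-- Transport plans as finite matrices, and operations on them.

module FiniteTransport (ℝ : RealNumbers) {A : Set} (d : A → A → ℕ)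
                       {L₁ L₂ : List A} (L₁! : Unique L₁) (L₂! : Unique L₂) where
  open RealNumbers ℝ
  open RealArithmetic ℝ
  open FiniteSums ℝ {A}

  -- The marginals are arbitrary functions, so that a rescaled plan, or one with mass added or
  -- withdrawn, is again a plan. The bound by one in `IsTransportPlan` is recovered later from the
  -- row sums.
  record FinitePlan (ρ σ : A → Carrier) : Set where
    field
      mass   : A → A → Carrier
      nonNeg : ∀ v w → 0# ≤ mass v w
      row    : ∀ {v} → v ∈ L₁ → ∑ L₂ (mass v) ≈ ρ v
      column : ∀ {w} → w ∈ L₂ → ∑ L₁ (λ v → mass v w) ≈ σ w

  open FinitePlan

  total : (A → A → Carrier) → Carrier
  total m = ∑ L₁ λ v → ∑ L₂ λ w → fromℕ (d v w) * m v w

  cost : ∀ {ρ σ} → FinitePlan ρ σ → Carrier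
  cost π = total (mass π)

  cell : A → A → A → A → Carrier
  cell a b v w = indicator a v * indicator b w

  bump : (A → A → Carrier) → Carrier → A → A → A → A → Carrier
  bump m t a b v w = m v w + t * cell a b v w

  abstract
    cell-self : ∀ a b → cell a b a b ≈ 1#
    cell-self a b = trans (*-cong (indicator-self a) (indicator-self b)) (*-identityˡ 1#)

    cell-≢ˡ : ∀ {a b v w} → v ≢ a → cell a b v w ≈ 0#
    cell-≢ˡ v≢a = trans (*-congʳ (indicator-≢ v≢a)) (zeroˡ _)

    cell-≢ʳ : ∀ {a b v w} → w ≢ b → cell a b v w ≈ 0#
    cell-≢ʳ w≢b = trans (*-congˡ (indicator-≢ w≢b)) (zeroʳ _)

    cell-nonNeg : ∀ a b v w → 0# ≤ cell a b v w
    cell-nonNeg a b v w = *-nonNeg (indicator-nonNeg a v) (indicator-nonNeg b w)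

    bump-unchanged : ∀ m t {a b v w} → cell a b v w ≈ 0# → bump m t a b v w ≈ m v w
    bump-unchanged m t off = trans (+-congˡ (trans (*-congˡ off) (zeroʳ t))) (+-identityʳ _)

    bump-self : ∀ m t a b → bump m t a b a b ≈ m a b + t
    bump-self m t a b = +-congˡ (trans (*-congˡ (cell-self a b)) (*-identityʳ t))

    bump-≥ : ∀ m {t} → 0# ≤ t → ∀ a b v w → m v w ≤ bump m t a b v w
    bump-≥ m {t} 0≤t a b v w = ≤-difference (*-nonNeg 0≤t (cell-nonNeg a b v w))
      (solve 3 (λ m t c → t :* c := (m :+ t :* c) :- m) refl (m v w) t (cell a b v w))

    bump-nonNeg : ∀ {m t a b} → (∀ v w → 0# ≤ m v w) → 0# ≤ m a b + t → ∀ v w → 0# ≤ bump m t a b v w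
    bump-nonNeg {m} {t} {a} {b} 0≤m 0≤mt v w with excluded-middle (v ≡ a) | excluded-middle (w ≡ b)
    ... | yes ≡.refl | yes ≡.refl = ≤-respʳ-≈ (sym (bump-self m t a b)) 0≤mt
    ... | yes _      | no w≢b     = ≤-respʳ-≈ (sym (bump-unchanged m t (cell-≢ʳ w≢b))) (0≤m v w)
    ... | no v≢a     | _          = ≤-respʳ-≈ (sym (bump-unchanged m t (cell-≢ˡ v≢a))) (0≤m v w)

    ∑-cell : ∀ {L b} → Unique L → b ∈ L → ∀ (f : A → Carrier) t → ∑ L (λ w → t * (f w * indicator b w)) ≈ t * f b
    ∑-cell {L} {b} L! b∈L f t = trans (∑-*ˡ L t _) (*-congˡ (∑-indicator L! b∈L f))

    bump-row : ∀ m t a {b} → b ∈ L₂ → ∀ v → ∑ L₂ (bump m t a b v) ≈ ∑ L₂ (m v) + t * indicator a v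
    bump-row m t a b∈L₂ v = trans (∑-+ L₂ _ _) (+-congˡ (∑-cell L₂! b∈L₂ (λ _ → indicator a v) t))

    bump-column : ∀ m t {a} b → a ∈ L₁ → ∀ w → ∑ L₁ (λ v → bump m t a b v w) ≈ ∑ L₁ (λ v → m v w) + t * indicator b w
    bump-column m t {a} b a∈L₁ w = trans (∑-+ L₁ _ _) (+-congˡ (trans
      (∑-cong L₁ λ _ → *-congˡ (*-comm _ _)) (∑-cell L₁! a∈L₁ (λ _ → indicator b w) t)))

    bump-total : ∀ m t {a b} → a ∈ L₁ → b ∈ L₂ → total (bump m t a b) ≈ total m + t * fromℕ (d a b)
    bump-total m t {a} {b} a∈L₁ b∈L₂ = trans
      (∑-cong L₁ λ {v} _ → trans
        (∑-cong L₂ λ {w} _ → solve 5 (λ D m t i j → D :* (m :+ t :* (i :* j)) := D :* m :+ t :* ((D :* i) :* j))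
          refl (fromℕ (d v w)) (m v w) t (indicator a v) (indicator b w))
        (trans (∑-+ L₂ _ _) (+-congˡ (∑-cell L₂! b∈L₂ (λ w → fromℕ (d v w) * indicator a v) t))))
      (trans (∑-+ L₁ _ _) (+-congˡ (∑-cell L₁! a∈L₁ (λ v → fromℕ (d v b)) t)))

  -- The amount `t` may be negative, which makes this the withdrawal operation as well.
  deposit : ∀ {ρ σ a b} (π : FinitePlan ρ σ) t → a ∈ L₁ → b ∈ L₂ → 0# ≤ mass π a b + t →
            FinitePlan (λ v → ρ v + t * indicator a v) (λ w → σ w + t * indicator b w)
  deposit {a = a} {b} π t a∈L₁ b∈L₂ 0≤mt = record
    { mass   = bump (mass π) t a b
    ; nonNeg = bump-nonNeg (nonNeg π) 0≤mt
    ; row    = λ v∈L₁ → trans (bump-row (mass π) t a b∈L₂ _) (+-congʳ (row π v∈L₁))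
    ; column = λ w∈L₂ → trans (bump-column (mass π) t b a∈L₁ _) (+-congʳ (column π w∈L₂))
    }

  scale : ∀ {ρ σ} k → 0# ≤ k → FinitePlan ρ σ → FinitePlan (λ v → k * ρ v) (λ w → k * σ w)
  scale k 0≤k π = record
    { mass   = λ v w → k * mass π v w
    ; nonNeg = λ v w → *-nonNeg 0≤k (nonNeg π v w)
    ; row    = λ v∈L₁ → trans (∑-*ˡ L₂ k _) (*-congˡ (row π v∈L₁))
    ; column = λ w∈L₂ → trans (∑-*ˡ L₁ k _) (*-congˡ (column π w∈L₂))
    }

  reweigh : ∀ {ρ σ ρ′ σ′} → (∀ {v} → v ∈ L₁ → ρ v ≈ ρ′ v) → (∀ {w} → w ∈ L₂ → σ w ≈ σ′ w) →
            FinitePlan ρ σ → FinitePlan ρ′ σ′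
  reweigh ρ≈ρ′ σ≈σ′ π = record
    { mass = mass π ; nonNeg = nonNeg π
    ; row = λ v∈L₁ → trans (row π v∈L₁) (ρ≈ρ′ v∈L₁) ; column = λ w∈L₂ → trans (column π w∈L₂) (σ≈σ′ w∈L₂) }

  abstract
    cost-deposit : ∀ {ρ σ a b} (π : FinitePlan ρ σ) t (a∈L₁ : a ∈ L₁) (b∈L₂ : b ∈ L₂) 0≤mt →
                   cost (deposit π t a∈L₁ b∈L₂ 0≤mt) ≈ cost π + t * fromℕ (d a b)
    cost-deposit π t a∈L₁ b∈L₂ _ = bump-total (mass π) t a∈L₁ b∈L₂

    cost-scale : ∀ {ρ σ} k 0≤k (π : FinitePlan ρ σ) → cost (scale k 0≤k π) ≈ k * cost π
    cost-scale k _ π = trans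
      (∑-cong L₁ λ {v} _ → trans
        (∑-cong L₂ λ {w} _ → solve 3 (λ D k m → D :* (k :* m) := k :* (D :* m)) refl (fromℕ (d v w)) k (mass π v w))
        (∑-*ˡ L₂ k _))
      (∑-*ˡ L₁ k _)

  -- Replaces a → b and c → e by a → e and c → b for an amount `t`. Both deposits precede the
  -- withdrawals, and `c≢a` separates the two withdrawn cells, so every intermediate matrix is
  -- nonnegative. The case b = e is allowed and changes nothing.
  module Exchange {ρ σ : A → Carrier} (π : FinitePlan ρ σ) {t} (0≤t : 0# ≤ t)
                  {a b c e : A} (a∈ : a ∈ L₁) (b∈ : b ∈ L₂) (c∈ : c ∈ L₁) (e∈ : e ∈ L₂)
                  (c≢a : c ≢ a) (t≤ab : t ≤ mass π a b) (t≤ce : t ≤ mass π c e) where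

    m₁ m₂ m₃ m₄ : A → A → Carrier
    m₁ = bump (mass π) t a e
    m₂ = bump m₁ t c b
    m₃ = bump m₂ (- t) a b
    m₄ = bump m₃ (- t) c e

    abstract
      m₂-≥ : ∀ v w → mass π v w ≤ m₂ v w
      m₂-≥ v w = ≤-trans (bump-≥ (mass π) 0≤t a e v w) (bump-≥ m₁ 0≤t c b v w)

      m₄-nonNeg : ∀ v w → 0# ≤ m₄ v w
      m₄-nonNeg = bump-nonNeg
        (bump-nonNeg (λ v w → ≤-trans (nonNeg π v w) (m₂-≥ v w)) (difference-nonNeg (≤-trans t≤ab (m₂-≥ a b))))
        (difference-nonNeg (≤-trans t≤ce (≤-respʳ-≈ (sym (bump-unchanged m₂ (- t) (cell-≢ˡ c≢a))) (m₂-≥ c e))))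

      m₄-row : ∀ v → ∑ L₂ (m₄ v) ≈ ∑ L₂ (mass π v)
      m₄-row v = trans (bump-row m₃ (- t) c e∈ v) (trans (+-congʳ (trans (bump-row m₂ (- t) a b∈ v) (+-congʳ
        (trans (bump-row m₁ t c b∈ v) (+-congʳ (bump-row (mass π) t a e∈ v))))))
        (solve 4 (λ s t i j → (((s :+ t :* i) :+ t :* j) :+ (:- t) :* i) :+ (:- t) :* j := s) refl
          (∑ L₂ (mass π v)) t (indicator a v) (indicator c v)))

      m₄-column : ∀ w → ∑ L₁ (λ v → m₄ v w) ≈ ∑ L₁ (λ v → mass π v w)
      m₄-column w = trans (bump-column m₃ (- t) e c∈ w) (trans (+-congʳ (trans (bump-column m₂ (- t) b a∈ w) (+-congʳ
        (trans (bump-column m₁ t b c∈ w) (+-congʳ (bump-column (mass π) t e a∈ w))))))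
        (solve 4 (λ s t i j → (((s :+ t :* i) :+ t :* j) :+ (:- t) :* j) :+ (:- t) :* i := s) refl
          (∑ L₁ (λ v → mass π v w)) t (indicator e w) (indicator b w)))

    exchange : FinitePlan ρ σ
    exchange = record
      { mass = m₄ ; nonNeg = m₄-nonNeg
      ; row = λ {v} v∈ → trans (m₄-row v) (row π v∈) ; column = λ {w} w∈ → trans (m₄-column w) (column π w∈) }

    abstract
      cost-exchange : cost exchange + t * (fromℕ (d a b) + fromℕ (d c e)) ≈ cost π + t * (fromℕ (d a e) + fromℕ (d c b))
      cost-exchange = trans
        (+-congʳ (trans (bump-total m₃ (- t) c∈ e∈) (+-congʳ (trans (bump-total m₂ (- t) a∈ b∈) (+-congʳ
          (trans (bump-total m₁ t c∈ b∈) (+-congʳ (bump-total (mass π) t a∈ e∈))))))))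
        (solve 6 (λ s t p q r u → ((((s :+ t :* p) :+ t :* q) :+ (:- t) :* r) :+ (:- t) :* u) :+ t :* (r :+ u) := s :+ t :* (p :+ q))
          refl (cost π) t (fromℕ (d a e)) (fromℕ (d c b)) (fromℕ (d a b)) (fromℕ (d c e)))

      -- If e = b, the deposit and the withdrawal meet in one cell and cancel, and `t≤ab` gives the
      -- bound; otherwise the deposit alone does.
      exchange-gain : t ≤ mass exchange a e
      exchange-gain = ≤-respʳ-≈ (sym (bump-unchanged m₃ (- t) (cell-≢ˡ (c≢a ∘ ≡.sym)))) gain₃
        where
        gain₂ : mass π a e + t ≤ m₂ a e
        gain₂ = ≤-respˡ-≈ (bump-self (mass π) t a e) (bump-≥ m₁ 0≤t c b a e)

        gain₃ : t ≤ m₃ a e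
        gain₃ with excluded-middle (e ≡ b)
        ... | no e≢b = ≤-respʳ-≈ (sym (bump-unchanged m₂ (- t) (cell-≢ʳ e≢b)))
                         (≤-trans (≤-difference (nonNeg π a e) (solve 2 (λ m t → m := (m :+ t) :- t) refl (mass π a e) t)) gain₂)
        ... | yes ≡.refl = ≤-respʳ-≈ (sym (bump-self m₂ (- t) a e)) (≤-difference
                             (+-nonNeg (difference-nonNeg t≤ab) (difference-nonNeg gain₂))
                             (solve 3 (λ m n t → (m :- t) :+ (n :- (m :+ t)) := (n :+ (:- t)) :- t) refl (mass π a e) (m₂ a e) t))

      -- Lets a second exchange find the mass it needs in a column that the first did not touch.
      exchange-≥ : ∀ {v w} → w ≢ b → w ≢ e → mass π v w ≤ mass exchange v w
      exchange-≥ w≢b w≢e = ≤-respʳ-≈ (sym (trans (bump-unchanged m₃ (- t) (cell-≢ʳ w≢e))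
        (bump-unchanged m₂ (- t) (cell-≢ʳ w≢b)))) (m₂-≥ _ _)

-- Rerouting any plan until a prescribed amount goes from x to y.

module Raising (ℝ : RealNumbers) {A : Set} (d : A → A → ℕ) {x y : A} {N₁ N₂ : List A}
  (L₁! : Unique (x ∷ N₁)) (L₂! : Unique (y ∷ N₂))
  (towards-N₂   : ∀ {z} → z ∈ N₂ → ∃ λ w → w ∈ N₁ × d w z ℕ.< d x z)
  (towards-y    : ∀ {w} → w ∈ N₁ → ∃ λ z → z ∈ N₂ × d w z ℕ.< d w y)
  (from-N₁      : ∀ {w} → w ∈ N₁ → d x y ℕ.≤ suc (d w y))
  (to-N₂        : ∀ {z} → z ∈ N₂ → d x y ℕ.≤ suc (d x z))
  (from-N₁-to-N₂ : ∀ {w z} → w ∈ N₁ → z ∈ N₂ → d x y ℕ.≤ suc (suc (d w z)))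
  where
  open RealNumbers ℝ
  open RealArithmetic ℝ
  open FiniteSums ℝ {A}
  open FiniteTransport ℝ d L₁! L₂! public
  open FinitePlan

  unique-head : ∀ {v} {N : List A} → Unique (v ∷ N) → ∀ {w} → w ∈ N → w ≢ v
  unique-head (v∉N ∷ _) w∈N = All.lookup v∉N w∈N ∘ ≡.sym

  N₁≢x : ∀ {w} → w ∈ N₁ → w ≢ x
  N₁≢x = unique-head L₁!

  N₂≢y : ∀ {z} → z ∈ N₂ → z ≢ y
  N₂≢y = unique-head L₂!

  module _ {ρ σ : A → Carrier} {a b : Carrier}
           (ρ≈a : ∀ {v} → v ∈ N₁ → ρ v ≈ a) (σ≈b : ∀ {w} → w ∈ N₂ → σ w ≈ b)
           (π : FinitePlan ρ σ) where

    abstract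
      -- Add up row w, column z and column y. Within the rows of `N₁` only (w,y) and (w,z) are
      -- counted twice, and those rows hold `length N₁` times `a` altogether; the row of x
      -- contributes (x,z) and (x,y).
      crossing-mass : ∀ {w z} → w ∈ N₁ → z ∈ N₂ →
        a + b + σ y ≤ fromℕ (length N₁) * a + mass π x y + mass π w y + mass π x z + mass π w z
      crossing-mass {w} {z} w∈ z∈ = begin
        a + b + σ y
          ≈⟨ +-cong (+-cong (row-split w∈) column-z) (column π (here ≡.refl)) ⟨
        rest w + (mass π w y + mass π w z) + (mass π x z + ∑ N₁ (λ v → mass π v z)) + (mass π x y + ∑ N₁ (λ v → mass π v y))
          ≤⟨ ≤-difference (difference-nonNeg (term≤∑ N₁ rest-nonNeg w∈))
               (solve 8 (λ r rw Y Z xy wy xz wz →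
                 r :- rw := ((r :+ (Y :+ Z)) :+ xy :+ wy :+ xz :+ wz) :- ((rw :+ (wy :+ wz)) :+ (xz :+ Z) :+ (xy :+ Y)))
               refl (∑ N₁ rest) (rest w) (∑ N₁ (λ v → mass π v y)) (∑ N₁ (λ v → mass π v z))
                    (mass π x y) (mass π w y) (mass π x z) (mass π w z)) ⟩
        (∑ N₁ rest + (∑ N₁ (λ v → mass π v y) + ∑ N₁ (λ v → mass π v z))) + mass π x y + mass π w y + mass π x z + mass π w z
          ≈⟨ +-congʳ (+-congʳ (+-congʳ (+-congʳ total-N₁))) ⟩
        fromℕ (length N₁) * a + mass π x y + mass π w y + mass π x z + mass π w z ∎
        where
        open ≤-Reasoning

        -- The mass of row `v` outside the columns y and z: `N₂` already omits y.
        rest : A → Carrier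
        rest v = ∑ N₂ (mass π v) - mass π v z

        rest-nonNeg : ∀ {v} → v ∈ N₁ → 0# ≤ rest v
        rest-nonNeg {v} _ = difference-nonNeg (term≤∑ N₂ (λ {w} _ → nonNeg π v w) z∈)

        row-split : ∀ {v} → v ∈ N₁ → rest v + (mass π v y + mass π v z) ≈ a
        row-split {v} v∈ = trans
          (solve 3 (λ s vy vz → (s :- vz) :+ (vy :+ vz) := vy :+ s) refl (∑ N₂ (mass π v)) (mass π v y) (mass π v z))
          (trans (row π (there v∈)) (ρ≈a v∈))

        column-z : mass π x z + ∑ N₁ (λ v → mass π v z) ≈ b
        column-z = trans (column π (there z∈)) (σ≈b z∈)

        total-N₁ : ∑ N₁ rest + (∑ N₁ (λ v → mass π v y) + ∑ N₁ (λ v → mass π v z)) ≈ fromℕ (length N₁) * a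
        total-N₁ = trans (sym (trans (∑-+ N₁ _ _) (+-congˡ (∑-+ N₁ _ _)))) (trans (∑-cong N₁ row-split) (∑-const N₁ a))

    Raised : Carrier → Set
    Raised t = Σ (FinitePlan ρ σ) λ π′ → cost π′ ≤ cost π × t ≤ mass π′ x y

    abstract
      raise-by-exchange : ∀ {t} → 0# ≤ t → ∀ {v w} → v ∈ N₁ → w ∈ N₂ →
        t ≤ mass π x w → t ≤ mass π v y → d x y ℕ.+ d v w ℕ.≤ d x w ℕ.+ d v y → Raised t
      raise-by-exchange {t} 0≤t {v} {w} v∈ w∈ t≤xw t≤vy le =
        X.exchange ,
        ≤-difference (*-nonNeg 0≤t (difference-nonNeg (fromℕ-mono-+ (d x y) (d v w) (d x w) (d v y) le)))
          (trans (solve 4 (λ s t p q → t :* (p :- q) := (s :+ t :* p) :- (s :+ t :* q)) refl (cost π) t p q)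
          (trans (+-congˡ (-‿cong (sym X.cost-exchange)))
            (solve 4 (λ s c t p → (s :+ t :* p) :- (c :+ t :* p) := s :- c) refl (cost π) (cost X.exchange) t p))) ,
        X.exchange-gain
        where
        module X = Exchange π 0≤t (here ≡.refl) (there w∈) (there v∈) (here ≡.refl) (N₁≢x v∈) t≤xw t≤vy
        p q : Carrier
        p = fromℕ (d x w) + fromℕ (d v y)
        q = fromℕ (d x y) + fromℕ (d v w)

      -- Two exchanges compose to a three-cycle: the first sends x → z, w′ → z′ to x → z′, w′ → z,
      -- the second sends x → z′, w → y to x → y, w → z′. Only the total cost is controlled, since
      -- the term d(x,z′) cancels between them. The mass at (w,y) survives the first exchange
      -- because y is neither z nor z′.
      raise-by-double-exchange : ∀ {t} → 0# ≤ t → ∀ {w w′ z z′} → w ∈ N₁ → w′ ∈ N₁ → z ∈ N₂ → z′ ∈ N₂ →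
        t ≤ mass π x z → t ≤ mass π w y → t ≤ mass π w′ z′ →
        (d x y ℕ.+ d w z′) ℕ.+ d w′ z ℕ.≤ (d x z ℕ.+ d w y) ℕ.+ d w′ z′ → Raised t
      raise-by-double-exchange {t} 0≤t {w} {w′} {z} {z′} w∈ w′∈ z∈ z′∈ t≤xz t≤wy t≤w′z′ le =
        Y.exchange ,
        ≤-difference (*-nonNeg 0≤t (difference-nonNeg le′))
          (trans (solve 8 (λ s t xy wz′ w′z xz wy w′z′ → t :* (((xz :+ wy) :+ w′z′) :- ((xy :+ wz′) :+ w′z)) :=
                    (s :+ t :* (xz :+ w′z′)) :- (s :+ t :* (((xy :+ wz′) :+ w′z) :- wy)))
                  refl (cost π) t (D x y) (D w z′) (D w′ z) (D x z) (D w y) (D w′ z′))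
          (trans (solve 11 (λ s s₁ s₂ t xy wz′ w′z xz wy w′z′ xz′ →
                    (s :+ t :* (xz :+ w′z′)) :- (s :+ t :* (((xy :+ wz′) :+ w′z) :- wy)) :=
                    s :- (s₂ :+ ((s :+ t :* (xz′ :+ w′z)) :- (s₁ :+ t :* (xz :+ w′z′))) :+ ((s₁ :+ t :* (xy :+ wz′)) :- (s₂ :+ t :* (xz′ :+ wy)))))
                  refl (cost π) (cost X.exchange) (cost Y.exchange) t (D x y) (D w z′) (D w′ z) (D x z) (D w y) (D w′ z′) (D x z′))
            (+-congˡ (-‿cong (trans (+-cong (trans (+-congˡ (zero-difference X.cost-exchange)) (+-identityʳ _))
              (zero-difference Y.cost-exchange)) (+-identityʳ _)))))) ,
        Y.exchange-gain
        where
        D : A → A → Carrier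
        D v w = fromℕ (d v w)

        module X = Exchange π 0≤t (here ≡.refl) (there z∈) (there w′∈) (there z′∈) (N₁≢x w′∈) t≤xz t≤w′z′
        module Y = Exchange X.exchange 0≤t (here ≡.refl) (there z′∈) (there w∈) (here ≡.refl) (N₁≢x w∈)
          X.exchange-gain (≤-trans t≤wy (X.exchange-≥ (N₂≢y z∈ ∘ ≡.sym) (N₂≢y z′∈ ∘ ≡.sym)))

        zero-difference : ∀ {u v} → u ≈ v → v - u ≈ 0#
        zero-difference {u} u≈v = trans (+-congʳ (sym u≈v)) (-‿inverseʳ u)

        le′ : (D x y + D w z′) + D w′ z ≤ (D x z + D w y) + D w′ z′
        le′ = ≤-respˡ-≈ (+-congʳ (fromℕ-+ (d x y) (d w z′))) (≤-respʳ-≈ (+-congʳ (fromℕ-+ (d x z) (d w y)))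
            (fromℕ-mono-+ (d x y ℕ.+ d w z′) (d w′ z) (d x z ℕ.+ d w y) (d w′ z′) le))

      -- If (x,y) holds less than `t`, the fourth hypothesis on `ρ x` leaves more than `length N₂`
      -- times `t` for the rest of row x, so one of its cells holds `t`; the bound on `σ y` does the
      -- same for column y. The summand `fromℕ 4 * t` allows one `t` for each of the four cells of
      -- `crossing-mass`.
      raise : ∀ {t} → 0# < t →
        (fromℕ (length N₁) + 1#) * t ≤ σ y → (fromℕ (length N₂) + 1#) * t ≤ ρ x →
        fromℕ (length N₁) * a + fromℕ 4 * t ≤ a + b + σ y → Raised t
      raise {t} 0<t small₁ small₂ crossing with ≤-or-> t (mass π x y)
      ... | inj₁ t≤xy = π , ≤-refl , t≤xy
      ... | inj₂ xy<t =
        let z , z∈ , t≤xz = ∑-large-term N₂ large-row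
            w , w∈ , t≤wy = ∑-large-term N₁ large-column
            w′ , w′∈ , w′z<xz = towards-N₂ z∈
            z′ , z′∈ , wz′<wy = towards-y w∈
        in choose z∈ t≤xz w∈ t≤wy w′∈ w′z<xz z′∈ wz′<wy
        where
        large-row : fromℕ (length N₂) * t < ∑ N₂ (mass π x)
        large-row = <-difference (+-pos-nonNeg (difference-pos xy<t) (difference-nonNeg (≤-respʳ-≈ (sym (row π (here ≡.refl))) small₂)))
          (solve 4 (λ n t xy s → (t :- xy) :+ ((xy :+ s) :- (n :+ :1) :* t) := s :- n :* t) refl (fromℕ (length N₂)) t (mass π x y) _)

        large-column : fromℕ (length N₁) * t < ∑ N₁ (λ v → mass π v y)
        large-column = <-difference (+-pos-nonNeg (difference-pos xy<t) (difference-nonNeg (≤-respʳ-≈ (sym (column π (here ≡.refl))) small₁)))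
          (solve 4 (λ n t xy s → (t :- xy) :+ ((xy :+ s) :- (n :+ :1) :* t) := s :- n :* t) refl (fromℕ (length N₁)) t (mass π x y) _)

        choose : ∀ {w w′ z z′} → z ∈ N₂ → t ≤ mass π x z → w ∈ N₁ → t ≤ mass π w y →
                 w′ ∈ N₁ → d w′ z ℕ.< d x z → z′ ∈ N₂ → d w z′ ℕ.< d w y → Raised t
        choose {w} {w′} {z} {z′} z∈ t≤xz w∈ t≤wy w′∈ w′z<xz z′∈ wz′<wy
          with ≤-or-> t (mass π w′ y) | ≤-or-> t (mass π x z′)
        ... | inj₁ t≤w′y | _ = raise-by-exchange (<⇒≤ 0<t) w′∈ z∈ t≤xz t≤w′y
                (ℕ-sum (from-N₁ w′∈) w′z<xz)
          where
          ℕ-sum : ∀ {i j k l} → i ℕ.≤ suc l → j ℕ.< k → i ℕ.+ j ℕ.≤ k ℕ.+ l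
          ℕ-sum {i} {j} {k} {l} i≤ j<k = ℕ.≤-trans (ℕ.+-mono-≤ i≤ ℕ.≤-refl)
            (≡.subst (ℕ._≤ k ℕ.+ l) (≡.cong suc (ℕ.+-comm j l)) (ℕ.+-monoˡ-≤ l j<k))
        ... | inj₂ _ | inj₁ t≤xz′ = raise-by-exchange (<⇒≤ 0<t) w∈ z′∈ t≤xz′ t≤wy
                (ℕ.≤-trans (ℕ.+-monoˡ-≤ (d w z′) (to-N₂ z′∈)) (≡.subst (ℕ._≤ d x z′ ℕ.+ d w y) (ℕ.+-suc (d x z′) (d w z′)) (ℕ.+-monoʳ-≤ (d x z′) wz′<wy)))
        ... | inj₂ w′y<t | inj₂ xz′<t = raise-by-double-exchange (<⇒≤ 0<t) w∈ w′∈ z∈ z′∈ t≤xz t≤wy t≤w′z′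
                (ℕ.≤-trans (ℕ.+-monoˡ-≤ (d w′ z) (ℕ.+-monoˡ-≤ (d w z′) (from-N₁-to-N₂ w′∈ z′∈)))
                  (≡.subst (ℕ._≤ (d x z ℕ.+ d w y) ℕ.+ d w′ z′) (rearrange (d w′ z) (d w z′) (d w′ z′))
                    (ℕ.+-monoˡ-≤ (d w′ z′) (ℕ.+-mono-≤ w′z<xz wz′<wy))))
          where
          rearrange : ∀ i j k → (suc i ℕ.+ suc j) ℕ.+ k ≡ (suc (suc k) ℕ.+ j) ℕ.+ i
          rearrange = ℕ-Solver.solve-∀

          -- The four cells hold at least `4 t` together and the other three hold less than `t`
          -- each.
          t≤w′z′ : t ≤ mass π w′ z′
          t≤w′z′ = ≤-difference (+-nonNeg (+-nonNeg (+-nonNeg (difference-nonNeg crossing) (difference-nonNeg (crossing-mass w′∈ z′∈)))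
              (<⇒≤ (difference-pos xy<t))) (+-nonNeg (<⇒≤ (difference-pos w′y<t)) (<⇒≤ (difference-pos xz′<t))))
            (solve 7 (λ t na abs xy wy xz wz →
               ((abs :- (na :+ (:1 :+ (:1 :+ (:1 :+ (:1 :+ :0)))) :* t)) :+ ((na :+ xy :+ wy :+ xz :+ wz) :- abs)) :+ (t :- xy)
                 :+ ((t :- wy) :+ (t :- xz)) := wz :- t)
             refl t (fromℕ (length N₁) * a) (a + b + σ y) (mass π x y) (mass π w′ y) (mass π x z′) (mass π w′ z′))

-- Distances in the graph around x and y.

module GraphDistance (ℝ : RealNumbers) (G : LocallyFiniteGraph) where
  open RealNumbers ℝ using (excluded-middle)
  open LocallyFiniteGraph G

  neighbour⇒~ : ∀ {v w} → w ∈ neighbours v → w ~ v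
  neighbour⇒~ {v} {w} = Equivalence.to (∈-neighbours v w)

  ~⇒neighbour : ∀ {v w} → w ~ v → w ∈ neighbours v
  ~⇒neighbour {v} {w} = Equivalence.from (∈-neighbours v w)

  infixl 5 _∷ʳ_
  _∷ʳ_ : ∀ {u v w n} → Walk u v n → v ~ w → Walk u w (suc n)
  []         ∷ʳ v~w = v~w ∷ []
  (u~t ∷ ws) ∷ʳ v~w = u~t ∷ (ws ∷ʳ v~w)

  last-step : ∀ {u v n} → Walk u v (suc n) → ∃ λ t → t ~ v × Walk u t n
  last-step (u~v ∷ []) = _ , u~v , []
  last-step (u~s ∷ ws@(_ ∷ _)) = let t , t~v , ws′ = last-step ws in t , t~v , u~s ∷ ws′

  -- Descent with `k` bounding the length: as long as excluded middle yields a shorter walk, pass to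
  -- it.
  shortest-walk : ∀ {v w} k {n} → n ℕ.≤ k → Walk v w n → ∃ (IsDistance v w)
  shortest-walk zero ℕ.z≤n ws = zero , ws , λ _ _ → ℕ.z≤n
  shortest-walk {v} {w} (suc k) {n} n≤1+k ws with excluded-middle (∃ λ m → m ℕ.< n × Walk v w m)
  ... | yes (m , m<n , ws′) = shortest-walk k (ℕ.≤-pred (ℕ.≤-trans m<n n≤1+k)) ws′
  ... | no ¬shorter         = n , ws , λ m ws′ → ℕ.≮⇒≥ λ m<n → ¬shorter (m , m<n , ws′)

  abstract
    -- Total so that it can serve as a cost coefficient; zero is a junk value for vertices in
    -- different components. By `connected` it never stands for such a pair within the two closed
    -- neighbourhoods.
    dist : V → V → ℕ
    dist v w with excluded-middle (∃ (IsDistance v w))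
    ... | yes (n , _) = n
    ... | no _        = zero

    dist-isDistance : ∀ {v w n} → Walk v w n → IsDistance v w (dist v w)
    dist-isDistance {v} {w} {n} ws with excluded-middle (∃ (IsDistance v w))
    ... | yes (_ , isDistance) = isDistance
    ... | no ¬distance         = ⊥-elim (¬distance (shortest-walk n ℕ.≤-refl ws))

  IsDistance-unique : ∀ {v w m n} → IsDistance v w m → IsDistance v w n → m ≡ n
  IsDistance-unique {m = m} {n} (ws , shortest) (ws′ , shortest′) = ℕ.≤-antisym (shortest n ws′) (shortest′ m ws)

  dist-≡ : ∀ {v w n} → IsDistance v w n → dist v w ≡ n
  dist-≡ d@(ws , _) = IsDistance-unique (dist-isDistance ws) d

  dist-walk : ∀ {v w n} → Walk v w n → Walk v w (dist v w)
  dist-walk ws = proj₁ (dist-isDistance ws)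

  dist-≤ : ∀ {v w n} → Walk v w n → dist v w ℕ.≤ n
  dist-≤ ws = proj₂ (dist-isDistance ws) _ ws

  closed-neighbours-unique : ∀ v → Unique (v ∷ neighbours v)
  closed-neighbours-unique v =
    All.tabulate (λ w∈ → λ { ≡.refl → ~-irrefl v (neighbour⇒~ w∈) }) ∷ neighbours-unique v

  module Between {x y δ} (isDistance : IsDistance x y δ) (2≤δ : 2 ℕ.≤ δ) where

    x⇝y : Walk x y δ
    x⇝y = proj₁ isDistance

    x≁y : ¬ x ~ y
    x≁y x~y with ℕ.≤-trans 2≤δ (proj₂ isDistance 1 (x~y ∷ []))
    ... | ℕ.s≤s ()

    from-x⇝ : ∀ {v} → v ∈ x ∷ neighbours x → ∃ (Walk v y)
    from-x⇝ (here ≡.refl) = _ , x⇝y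
    from-x⇝ (there v∈)    = _ , neighbour⇒~ v∈ ∷ x⇝y

    connected : ∀ {v w} → v ∈ x ∷ neighbours x → w ∈ y ∷ neighbours y → ∃ (Walk v w)
    connected v∈ (here ≡.refl) = from-x⇝ v∈
    connected v∈ (there w∈)    = _ , proj₂ (from-x⇝ v∈) ∷ʳ ~-sym (neighbour⇒~ w∈)

    first-neighbour : ∀ {z n} → z ≢ x → Walk x z n → ∃ λ w → w ∈ neighbours x × dist w z ℕ.< n
    first-neighbour z≢x []         = ⊥-elim (z≢x ≡.refl)
    first-neighbour z≢x (x~w ∷ ws) = _ , ~⇒neighbour (~-sym x~w) , ℕ.s≤s (dist-≤ ws)

    last-neighbour : ∀ {w n} → w ≢ y → Walk w y n → ∃ λ z → z ∈ neighbours y × dist w z ℕ.< n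
    last-neighbour {n = zero}  w≢y [] = ⊥-elim (w≢y ≡.refl)
    last-neighbour {n = suc n} w≢y ws =
      let z , z~y , ws′ = last-step ws in z , ~⇒neighbour z~y , ℕ.s≤s (dist-≤ ws′)

    -- Here δ ≥ 2 enters: x is not adjacent to y, hence z differs from x and a geodesic from x to z
    -- has a first edge.
    towards-N₂ : ∀ {z} → z ∈ neighbours y → ∃ λ w → w ∈ neighbours x × dist w z ℕ.< dist x z
    towards-N₂ z∈ = first-neighbour (λ { ≡.refl → x≁y (neighbour⇒~ z∈) })
      (dist-walk (proj₂ (connected (here ≡.refl) (there z∈))))

    towards-y : ∀ {w} → w ∈ neighbours x → ∃ λ z → z ∈ neighbours y × dist w z ℕ.< dist w y
    towards-y w∈ = last-neighbour (λ { ≡.refl → x≁y (~-sym (neighbour⇒~ w∈)) })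
      (dist-walk (proj₂ (connected (there w∈) (here ≡.refl))))

    from-N₁ : ∀ {w} → w ∈ neighbours x → dist x y ℕ.≤ suc (dist w y)
    from-N₁ w∈ = dist-≤ (~-sym (neighbour⇒~ w∈) ∷ dist-walk (proj₂ (connected (there w∈) (here ≡.refl))))

    to-N₂ : ∀ {z} → z ∈ neighbours y → dist x y ℕ.≤ suc (dist x z)
    to-N₂ z∈ = dist-≤ (dist-walk (proj₂ (connected (here ≡.refl) (there z∈))) ∷ʳ neighbour⇒~ z∈)

    from-N₁-to-N₂ : ∀ {w z} → w ∈ neighbours x → z ∈ neighbours y → dist x y ℕ.≤ suc (suc (dist w z))
    from-N₁-to-N₂ w∈ z∈ = dist-≤ (~-sym (neighbour⇒~ w∈) ∷ (dist-walk (proj₂ (connected (there w∈) (there z∈))) ∷ʳ neighbour⇒~ z∈))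

    y≢x : y ≢ x
    y≢x ≡.refl with ℕ.≤-trans 2≤δ (proj₂ isDistance 0 [])
    ... | ()

    nonempty : ∀ {v : V} {L} → v ∈ L → 1 ℕ.≤ length L
    nonempty (here _)  = ℕ.s≤s ℕ.z≤n
    nonempty (there _) = ℕ.s≤s ℕ.z≤n

    1≤degree-x : 1 ℕ.≤ degree x
    1≤degree-x = let _ , w∈ , _ = first-neighbour y≢x x⇝y in nonempty w∈

    1≤degree-y : 1 ℕ.≤ degree y
    1≤degree-y = let _ , z∈ , _ = last-neighbour (y≢x ∘ ≡.sym) x⇝y in nonempty z∈

-- The measures of the lazy random walk.

module LazyWalkMeasure (ℝ : RealNumbers) (G : LocallyFiniteGraph) where
  open RealNumbers ℝ
  open RealArithmetic ℝ
  open LocallyFiniteGraph G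
  open Curvature ℝ G using (μ)
  open GraphDistance ℝ G
  open FiniteSums ℝ {V}

  abstract
    μ-self : ∀ p v → μ p v v ≈ p
    μ-self p v with excluded-middle (v ≡ v) | excluded-middle (v ~ v)
    ... | yes _  | _ = refl
    ... | no v≢v | _ = ⊥-elim (v≢v ≡.refl)

    μ-neighbour : ∀ p {v z} → z ∈ neighbours v → μ p v z ≈ (1# - p) / fromℕ (degree v)
    μ-neighbour p {v} {z} z∈ with excluded-middle (z ≡ v) | excluded-middle (z ~ v)
    ... | yes ≡.refl | _      = ⊥-elim (~-irrefl v (neighbour⇒~ z∈))
    ... | no _       | yes _  = refl
    ... | no _       | no z≁v = ⊥-elim (z≁v (neighbour⇒~ z∈))

    μ-outside : ∀ p {v z} → z ∉ v ∷ neighbours v → μ p v z ≈ 0#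
    μ-outside p {v} {z} z∉ with excluded-middle (z ≡ v) | excluded-middle (z ~ v)
    ... | yes z≡v | _       = ⊥-elim (z∉ (here z≡v))
    ... | no _    | yes z~v = ⊥-elim (z∉ (there (~⇒neighbour z~v)))
    ... | no _    | no _    = refl

    μ-nonNeg : ∀ {p} → 0# ≤ p → p ≤ 1# → ∀ {v} → 1 ℕ.≤ degree v → ∀ z → 0# ≤ μ p v z
    μ-nonNeg {p} 0≤p p≤1 {v} 1≤deg z = by-membership (excluded-middle (z ∈ v ∷ neighbours v))
      where
      by-membership : Dec (z ∈ v ∷ neighbours v) → 0# ≤ μ p v z
      by-membership (yes (here ≡.refl)) = ≤-respʳ-≈ (sym (μ-self p v)) 0≤p
      by-membership (yes (there z∈))    = ≤-respʳ-≈ (sym (μ-neighbour p z∈))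
        (*-nonNeg (difference-nonNeg p≤1) (<⇒≤ (⁻¹-pos (1≤⇒fromℕ-pos 1≤deg))))
      by-membership (no z∉)             = ≤-reflexive (sym (μ-outside p z∉))

    μ-total : ∀ p {v} → 1 ℕ.≤ degree v → ∑ (v ∷ neighbours v) (μ p v) ≈ 1#
    μ-total p {v} 1≤deg = trans
      (+-cong (μ-self p v) (trans (trans (∑-cong (neighbours v) (μ-neighbour p)) (∑-const (neighbours v) _))
        (/-*-cancel (pos⇒≉0 (1≤⇒fromℕ-pos 1≤deg)))))
      (solve 1 (λ p → p :+ (:1 :- p) := :1) refl p)

    μ-≤1 : ∀ {p} → 0# ≤ p → p ≤ 1# → ∀ {v} → 1 ℕ.≤ degree v → ∀ z → μ p v z ≤ 1#
    μ-≤1 {p} 0≤p p≤1 {v} 1≤deg z = by-membership (excluded-middle (z ∈ v ∷ neighbours v))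
      where
      by-membership : Dec (z ∈ v ∷ neighbours v) → μ p v z ≤ 1#
      by-membership (yes z∈) = ≤-respʳ-≈ (μ-total p 1≤deg) (term≤∑ (v ∷ neighbours v) (λ {w} _ → μ-nonNeg 0≤p p≤1 1≤deg w) z∈)
      by-membership (no z∉)  = ≤-respˡ-≈ (sym (μ-outside p z∉)) (<⇒≤ 0<1)

    -- Raising the laziness mixes in a point mass at `v`: neighbours only see the factor k, while
    -- `v` itself also receives ε.
    μ-combination : ∀ {p q k ε} → q ≈ k * p + ε → 1# - q ≈ k * (1# - p) →
                    ∀ v z → k * μ p v z + ε * indicator v z ≈ μ q v z
    μ-combination {p} {q} {k} {ε} q≈ 1-q≈ v z = by-membership (excluded-middle (z ∈ v ∷ neighbours v))
      where
      away : z ≢ v → k * μ p v z + ε * indicator v z ≈ k * μ p v z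
      away z≢v = trans (+-congˡ (trans (*-congˡ (indicator-≢ z≢v)) (zeroʳ ε))) (+-identityʳ _)

      by-membership : Dec (z ∈ v ∷ neighbours v) → k * μ p v z + ε * indicator v z ≈ μ q v z
      by-membership (yes (here ≡.refl)) = trans
        (+-cong (*-congˡ (μ-self p v)) (trans (*-congˡ (indicator-self v)) (*-identityʳ ε))) (trans (sym q≈) (sym (μ-self q v)))
      by-membership (yes (there z∈)) = trans (away λ { ≡.refl → ~-irrefl v (neighbour⇒~ z∈) })
        (trans (*-congˡ (μ-neighbour p z∈)) (trans (sym (*-assoc _ _ _)) (trans (*-congʳ (sym 1-q≈)) (sym (μ-neighbour q z∈)))))
      by-membership (no z∉) = trans (away (z∉ ∘ here))
        (trans (*-congˡ (μ-outside p z∉)) (trans (zeroʳ k) (sym (μ-outside q z∉))))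

-- The Wasserstein distance through finite plans, and its interpolation in the laziness.

module TransportDistance (ℝ : RealNumbers) (G : LocallyFiniteGraph)
  {x y : LocallyFiniteGraph.V G} {δ : ℕ}
  (isDistance : LocallyFiniteGraph.IsDistance G x y δ) (2≤δ : 2 ℕ.≤ δ) where
  open RealNumbers ℝ
  open RealArithmetic ℝ
  open Infima ℝ
  open LocallyFiniteGraph G
  open Curvature ℝ G
  open GraphDistance ℝ G
  open Between isDistance 2≤δ
  open LazyWalkMeasure ℝ G
  open FiniteSums ℝ {V}
  open Raising ℝ dist (closed-neighbours-unique x) (closed-neighbours-unique y)
    towards-N₂ towards-y from-N₁ to-N₂ from-N₁-to-N₂
  open FinitePlan

  L₁ L₂ : List V
  L₁ = x ∷ neighbours x
  L₂ = y ∷ neighbours y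

  Plan : Carrier → Set
  Plan p = FinitePlan (μ p x) (μ p y)

  W : Carrier → Carrier
  W p = W₁ (μ p x) (μ p y)

  AdmissibleCost : Carrier → Carrier → Set
  AdmissibleCost p s = ∃ λ π → IsTransportPlan (μ p x) (μ p y) π × HasCost π s

  abstract
    -- For disconnected vertices the mass `r` is zero, so the junk value of `dist` does no harm.
    weighted-≈ : ∀ {v w r t} → WeightedDistance v w r t → t ≈ fromℕ (dist v w) * r
    weighted-≈ {v} {w} {r} (finite isDist t≈) = trans t≈ (*-congʳ (reflexive (≡.cong fromℕ (≡.sym (dist-≡ isDist)))))
    weighted-≈ (infinite _ r≈0 t≈0) = trans t≈0 (sym (trans (*-congˡ r≈0) (zeroʳ _)))

  module _ {p} (0≤p : 0# ≤ p) (p≤1 : p ≤ 1#) where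

    module Restriction {π : V → V → Carrier} (isPlan : IsTransportPlan (μ p x) (μ p y) π) where
      open IsTransportPlan isPlan renaming (nonNegative to π≥0)

      abstract
        -- An entry is at most its marginal, which is zero off the closed neighbourhood.
        vanishʳ : ∀ v {w} → w ∉ L₂ → π v w ≈ 0#
        vanishʳ v {w} w∉ = antisym (≤-respʳ-≈ (μ-outside p w∉) (hasSum⇒term≤ (marginal₂ w) v)) (π≥0 v w)

        vanishˡ : ∀ {v} w → v ∉ L₁ → π v w ≈ 0#
        vanishˡ {v} w v∉ = antisym (≤-respʳ-≈ (μ-outside p v∉) (hasSum⇒term≤ (marginal₁ v) w)) (π≥0 v w)

      restrict : Plan p
      restrict = record
        { mass   = π
        ; nonNeg = π≥0
        ; row    = λ {v} _ → sym (hasSum⇒≈∑ (π≥0 v) (closed-neighbours-unique y) (vanishʳ v) (marginal₁ v))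
        ; column = λ {w} _ → sym (hasSum⇒≈∑ (λ v → π≥0 v w) (closed-neighbours-unique x) (vanishˡ w) (marginal₂ w))
        }

      abstract
        -- `HasCost` only asserts that some `c` and `rows` exist, but both are forced and vanish off
        -- the two lists, so the iterated suprema collapse to a finite double sum.
        restrict-cost : ∀ {s} → HasCost π s → s ≈ cost restrict
        restrict-cost {s} (c , weighted , rows , rows-sum , total-sum) = trans
          (hasSum⇒≈∑ rows-nonNeg (closed-neighbours-unique x) rows-vanish total-sum)
          (∑-cong L₁ λ {v} _ → trans (rows≈ v) (∑-cong L₂ λ {w} _ → c≈ v w))
          where
          c≈ : ∀ v w → c v w ≈ fromℕ (dist v w) * π v w
          c≈ v w = weighted-≈ (weighted v w)

          c-nonNeg : ∀ v w → 0# ≤ c v w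
          c-nonNeg v w = ≤-respʳ-≈ (sym (c≈ v w)) (*-nonNeg (fromℕ-nonNeg (dist v w)) (π≥0 v w))

          c-vanish : ∀ {v w} → π v w ≈ 0# → c v w ≈ 0#
          c-vanish {v} {w} π≈0 = trans (c≈ v w) (trans (*-congˡ π≈0) (zeroʳ _))

          rows≈ : ∀ v → rows v ≈ ∑ L₂ (c v)
          rows≈ v = hasSum⇒≈∑ (c-nonNeg v) (closed-neighbours-unique y) (λ w∉ → c-vanish (vanishʳ v w∉)) (rows-sum v)

          rows-nonNeg : ∀ v → 0# ≤ rows v
          rows-nonNeg v = ≤-respʳ-≈ (sym (rows≈ v)) (∑-nonNeg L₂ λ {w} _ → c-nonNeg v w)

          rows-vanish : ∀ {v} → v ∉ L₁ → rows v ≈ 0#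
          rows-vanish {v} v∉ = trans (rows≈ v) (∑-zero L₂ λ {w} _ → c-vanish (vanishˡ w v∉))

    module Extension (F : Plan p) where
      abstract
        -- Cut off because a `FinitePlan` may hold arbitrary nonnegative mass outside the two lists.
        extended : V → V → Carrier
        extended v w with excluded-middle (v ∈ L₁ × w ∈ L₂)
        ... | yes _ = mass F v w
        ... | no _  = 0#

        extended-inside : ∀ {v w} → v ∈ L₁ → w ∈ L₂ → extended v w ≈ mass F v w
        extended-inside {v} {w} v∈ w∈ with excluded-middle (v ∈ L₁ × w ∈ L₂)
        ... | yes _ = refl
        ... | no ¬∈ = ⊥-elim (¬∈ (v∈ , w∈))

        extended-outside : ∀ {v w} → ¬ (v ∈ L₁ × w ∈ L₂) → extended v w ≈ 0#
        extended-outside {v} {w} ¬∈ with excluded-middle (v ∈ L₁ × w ∈ L₂)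
        ... | yes ∈ = ⊥-elim (¬∈ ∈)
        ... | no _  = refl

        extended-nonNeg : ∀ v w → 0# ≤ extended v w
        extended-nonNeg v w with excluded-middle (v ∈ L₁ × w ∈ L₂)
        ... | yes _ = nonNeg F v w
        ... | no _  = ≤-refl

        extended-row : ∀ v → HasSum (extended v) (μ p x v)
        extended-row v = hasSum-resp-≈ (by-membership (excluded-middle (v ∈ L₁)))
          (hasSum-∑ (extended-nonNeg v) (closed-neighbours-unique y) (λ w∉ → extended-outside (w∉ ∘ proj₂)))
          where
          by-membership : Dec (v ∈ L₁) → ∑ L₂ (extended v) ≈ μ p x v
          by-membership (yes v∈) = trans (∑-cong L₂ (extended-inside v∈)) (row F v∈)
          by-membership (no v∉)  = trans (∑-zero L₂ λ _ → extended-outside (v∉ ∘ proj₁)) (sym (μ-outside p v∉))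

        extended-column : ∀ w → HasSum (λ v → extended v w) (μ p y w)
        extended-column w = hasSum-resp-≈ (by-membership (excluded-middle (w ∈ L₂)))
          (hasSum-∑ (λ v → extended-nonNeg v w) (closed-neighbours-unique x) (λ v∉ → extended-outside (v∉ ∘ proj₁)))
          where
          by-membership : Dec (w ∈ L₂) → ∑ L₁ (λ v → extended v w) ≈ μ p y w
          by-membership (yes w∈) = trans (∑-cong L₁ λ v∈ → extended-inside v∈ w∈) (column F w∈)
          by-membership (no w∉)  = trans (∑-zero L₁ λ _ → extended-outside (w∉ ∘ proj₂)) (sym (μ-outside p w∉))

        extended-isPlan : IsTransportPlan (μ p x) (μ p y) extended
        extended-isPlan = record
          { nonNegative = extended-nonNeg
          ; atMostOne   = λ v w → ≤-trans (hasSum⇒term≤ (extended-row v) w) (μ-≤1 0≤p p≤1 1≤degree-x v)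
          ; marginal₁   = extended-row
          ; marginal₂   = extended-column
          }

        extended-hasCost : HasCost extended (cost F)
        extended-hasCost = c , weighted , (λ v → ∑ L₂ (c v)) ,
          (λ v → hasSum-∑ (c-nonNeg v) (closed-neighbours-unique y) λ w∉ → c-vanish (w∉ ∘ proj₂)) ,
          hasSum-resp-≈ (∑-cong L₁ λ v∈ → ∑-cong L₂ λ w∈ → *-congˡ (extended-inside v∈ w∈))
            (hasSum-∑ (λ v → ∑-nonNeg L₂ λ {w} _ → c-nonNeg v w) (closed-neighbours-unique x)
              λ v∉ → ∑-zero L₂ λ _ → c-vanish (v∉ ∘ proj₁))
          where
          c : V → V → Carrier
          c v w = fromℕ (dist v w) * extended v w

          c-nonNeg : ∀ v w → 0# ≤ c v w
          c-nonNeg v w = *-nonNeg (fromℕ-nonNeg (dist v w)) (extended-nonNeg v w)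

          c-vanish : ∀ {v w} → ¬ (v ∈ L₁ × w ∈ L₂) → c v w ≈ 0#
          c-vanish ¬∈ = trans (*-congˡ (extended-outside ¬∈)) (zeroʳ _)

          -- By `connected`, a pair without a walk lies outside the two lists and carries no mass,
          -- as `infinite` demands.
          by-connection : ∀ {v w} → Dec (∃ (Walk v w)) → WeightedDistance v w (extended v w) (c v w)
          by-connection (yes (_ , ws))     = finite (dist-isDistance ws) refl
          by-connection {v} {w} (no ¬walk) = infinite (λ n ws → ¬walk (n , ws)) (extended-outside apart) (c-vanish apart)
            where
            apart : ¬ (v ∈ L₁ × w ∈ L₂)
            apart (v∈ , w∈) = ¬walk (connected v∈ w∈)

          weighted : ∀ v w → WeightedDistance v w (extended v w) (c v w)
          weighted v w = by-connection (excluded-middle (∃ (Walk v w)))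

    -- The product coupling shows that the set of costs is inhabited, so that its infimum is
    -- genuine.
    independent : Plan p
    independent = record
      { mass   = λ v w → μ p x v * μ p y w
      ; nonNeg = λ v w → *-nonNeg (μ-nonNeg 0≤p p≤1 1≤degree-x v) (μ-nonNeg 0≤p p≤1 1≤degree-y w)
      ; row    = λ {v} _ → trans (∑-*ˡ L₂ (μ p x v) (μ p y)) (trans (*-congˡ (μ-total p 1≤degree-y)) (*-identityʳ _))
      ; column = λ {w} _ → trans (∑-cong L₁ λ _ → *-comm _ _)
          (trans (∑-*ˡ L₁ (μ p y w) (μ p x)) (trans (*-congˡ (μ-total p 1≤degree-x)) (*-identityʳ _)))
      }

    abstract
      extend : (F : Plan p) → AdmissibleCost p (cost F)
      extend F = Extension.extended F , Extension.extended-isPlan F , Extension.extended-hasCost F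

      cost-nonNeg : (F : Plan p) → 0# ≤ cost F
      cost-nonNeg F = ∑-nonNeg L₁ λ {v} _ → ∑-nonNeg L₂ λ {w} _ → *-nonNeg (fromℕ-nonNeg (dist v w)) (nonNeg F v w)

      W-isInf : IsInf (AdmissibleCost p) (W p)
      W-isInf = inf-isInf (_ , extend independent)
        λ { s (π , isPlan , hasCost) → ≤-respʳ-≈ (sym (Restriction.restrict-cost isPlan hasCost)) (cost-nonNeg (Restriction.restrict isPlan)) }

      W-≤ : (F : Plan p) → W p ≤ cost F
      W-≤ F = proj₁ W-isInf (cost F) (extend F)

      W-approximate : ∀ z → W p < z → Σ (Plan p) λ F → cost F < z
      W-approximate z W<z = let s , (π , isPlan , hasCost) , s<z = proj₂ W-isInf z W<z
        in Restriction.restrict isPlan , <-respˡ-≈ (Restriction.restrict-cost isPlan hasCost) s<z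

  -- A plan for p becomes one for q > p by scaling and depositing mass at (x , y);
  -- the converse needs mass at (x , y) to withdraw, which raise provides.
  module Interpolation {p q} (0≤p : 0# ≤ p) (p<q : p < q) (q<1 : q < 1#) where

    1-p>0 : 0# < 1# - p
    1-p>0 = difference-pos (<-trans p<q q<1)

    1-q>0 : 0# < 1# - q
    1-q>0 = difference-pos q<1

    -- `k` and `ε` are the weights of q between p and 1: q = k p + ε and k + ε = 1. Laziness 1 means
    -- a point mass, and moving that costs δ.
    k k⁻¹ ε : Carrier
    k   = (1# - q) / (1# - p)
    k⁻¹ = (1# - p) / (1# - q)
    ε   = (q - p) / (1# - p)

    abstract
      0<k : 0# < k
      0<k = *-pos 1-q>0 (⁻¹-pos 1-p>0)

      0<k⁻¹ : 0# < k⁻¹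
      0<k⁻¹ = *-pos 1-p>0 (⁻¹-pos 1-q>0)

      0<ε : 0# < ε
      0<ε = *-pos (difference-pos p<q) (⁻¹-pos 1-p>0)

      k⁻¹k≈1 : k⁻¹ * k ≈ 1#
      k⁻¹k≈1 = trans (solve 4 (λ s s′ t t′ → (s :* t′) :* (t :* s′) := (t :* t′) :* (s :* s′)) refl (1# - p) ((1# - p) ⁻¹) (1# - q) ((1# - q) ⁻¹))
        (trans (*-cong (*-inverseʳ (pos⇒≉0 1-q>0)) (*-inverseʳ (pos⇒≉0 1-p>0))) (*-identityˡ 1#))

      1-q≈ : 1# - q ≈ k * (1# - p)
      1-q≈ = trans (sym (/-*-cancel (pos⇒≉0 1-p>0))) (*-comm _ _)

      k+ε≈1 : k + ε ≈ 1#
      k+ε≈1 = trans (solve 3 (λ p q u → (:1 :- q) :* u :+ (q :- p) :* u := (:1 :- p) :* u) refl p q ((1# - p) ⁻¹))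
        (*-inverseʳ (pos⇒≉0 1-p>0))

      q≈ : q ≈ k * p + ε
      q≈ = trans (solve 1 (λ q → q := :1 :- (:1 :- q)) refl q) (trans (+-cong (sym k+ε≈1) (-‿cong 1-q≈))
        (solve 3 (λ k p ε → (k :+ ε) :- k :* (:1 :- p) := k :* p :+ ε) refl k p ε))

      μ-raised : ∀ v z → k * μ p v z + ε * indicator v z ≈ μ q v z
      μ-raised = μ-combination q≈ 1-q≈

      μ-lowered : ∀ v z → k⁻¹ * (μ q v z + - ε * indicator v z) ≈ μ p v z
      μ-lowered v z = trans (*-congˡ (+-congʳ (sym (μ-raised v z)))) (trans
        (solve 5 (λ k k′ m e i → k′ :* ((k :* m :+ e :* i) :+ (:- e) :* i) := (k′ :* k) :* m) refl k k⁻¹ (μ p v z) ε (indicator v z))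
        (trans (*-congʳ k⁻¹k≈1) (*-identityˡ _)))

    x∈ : x ∈ L₁
    x∈ = here ≡.refl

    y∈ : y ∈ L₂
    y∈ = here ≡.refl

    abstract
      d[x,y]≈δ : fromℕ (dist x y) ≈ fromℕ δ
      d[x,y]≈δ = reflexive (≡.cong fromℕ (dist-≡ isDistance))

      lift : (F : Plan p) → Σ (Plan q) λ F′ → cost F′ ≈ k * cost F + ε * fromℕ δ
      lift F = reweigh (λ {v} _ → μ-raised x v) (λ {w} _ → μ-raised y w) deposited ,
        trans (cost-deposit scaled ε x∈ y∈ room) (+-cong (cost-scale k (<⇒≤ 0<k) F) (*-congˡ d[x,y]≈δ))
        where
        scaled : FinitePlan (λ v → k * μ p x v) (λ w → k * μ p y w)
        scaled = scale k (<⇒≤ 0<k) F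
        room : 0# ≤ mass scaled x y + ε
        room = +-nonNeg (nonNeg scaled x y) (<⇒≤ 0<ε)
        deposited : FinitePlan (λ v → k * μ p x v + ε * indicator x v) (λ w → k * μ p y w + ε * indicator y w)
        deposited = deposit scaled ε x∈ y∈ room

      lower : (F : Plan q) → ε ≤ mass F x y → Σ (Plan p) λ F′ → cost F′ ≈ k⁻¹ * (cost F - ε * fromℕ δ)
      lower F ε≤xy = reweigh (λ {v} _ → μ-lowered x v) (λ {w} _ → μ-lowered y w) (scale k⁻¹ (<⇒≤ 0<k⁻¹) withdrawn) ,
        trans (cost-scale k⁻¹ (<⇒≤ 0<k⁻¹) withdrawn) (*-congˡ (trans (cost-deposit F (- ε) x∈ y∈ room)
          (+-congˡ (trans (*-congˡ d[x,y]≈δ) (solve 2 (λ e d → (:- e) :* d := :- (e :* d)) refl ε (fromℕ δ))))))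
        where
        room : 0# ≤ mass F x y - ε
        room = difference-nonNeg ε≤xy
        withdrawn : FinitePlan (λ v → μ q x v + - ε * indicator x v) (λ w → μ q y w + - ε * indicator y w)
        withdrawn = deposit F (- ε) x∈ y∈ room

      -- Each strict inequality is refuted by a near-optimal plan: lifted from p it would undercut W
      -- at q, and raised and then lowered from q it would undercut W at p. The hypotheses are those
      -- of `raise` for t = ε.
      W-interpolation :
        (fromℕ (degree x) + 1#) * ε ≤ q → (fromℕ (degree y) + 1#) * ε ≤ q →
        (1# - q) + fromℕ 4 * ε ≤ (1# - q) / fromℕ (degree x) + (1# - q) / fromℕ (degree y) + q →
        W q ≈ k * W p + ε * fromℕ δ
      W-interpolation small-x small-y crossing = antisym (≮⇒≥ ¬above) (≮⇒≥ ¬below)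
        where
        p≤1 : p ≤ 1#
        p≤1 = <⇒≤ (<-trans p<q q<1)
        0≤q : 0# ≤ q
        0≤q = <⇒≤ (≤-<-trans 0≤p p<q)

        target : Carrier
        target = k * W p + ε * fromℕ δ

        unscale : ∀ a → k⁻¹ * ((k * a + ε * fromℕ δ) - ε * fromℕ δ) ≈ a
        unscale a = trans (solve 4 (λ k k′ a e → k′ :* ((k :* a :+ e) :- e) := (k′ :* k) :* a) refl k k⁻¹ a (ε * fromℕ δ))
          (trans (*-congʳ k⁻¹k≈1) (*-identityˡ a))

        ¬above : ¬ target < W q
        ¬above target<Wq =
          -- Solves k z + ε δ = W q, so a plan for p cheaper than z lifts to one cheaper than W q.
          let z = k⁻¹ * (W q - ε * fromℕ δ)
              F , costF<z = W-approximate 0≤p p≤1 z (<-respˡ-≈ (unscale (W p))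
                              (*-monoˡ-< 0<k⁻¹ (+-monoˡ-< (- (ε * fromℕ δ)) target<Wq)))
              F′ , costF′≈ = lift F
          in ≤⇒≯ (W-≤ 0≤q (<⇒≤ q<1) F′) (<-respˡ-≈ (sym costF′≈) (<-respʳ-≈
               (trans (solve 4 (λ k k′ w e → k :* (k′ :* (w :- e)) :+ e := (k′ :* k) :* (w :- e) :+ e) refl k k⁻¹ (W q) (ε * fromℕ δ))
                 (trans (+-congʳ (trans (*-congʳ k⁻¹k≈1) (*-identityˡ _)))
                   (solve 2 (λ w e → (w :- e) :+ e := w) refl (W q) (ε * fromℕ δ))))
               (+-monoˡ-< (ε * fromℕ δ) (*-monoˡ-< 0<k costF<z))))

        crossing′ : fromℕ (degree x) * ((1# - q) / fromℕ (degree x)) + fromℕ 4 * ε ≤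
                    (1# - q) / fromℕ (degree x) + (1# - q) / fromℕ (degree y) + μ q y y
        crossing′ = ≤-respˡ-≈ (+-congʳ (sym (/-*-cancel (pos⇒≉0 (1≤⇒fromℕ-pos 1≤degree-x)))))
          (≤-respʳ-≈ (+-congˡ (sym (μ-self q y))) crossing)

        ¬below : ¬ W q < target
        ¬below Wq<target =
          let F , costF<target = W-approximate 0≤q (<⇒≤ q<1) target Wq<target
              F′ , costF′≤ , ε≤xy = raise (μ-neighbour q) (μ-neighbour q) F 0<ε
                (≤-respʳ-≈ (sym (μ-self q y)) small-x) (≤-respʳ-≈ (sym (μ-self q x)) small-y) crossing′
              F″ , costF″≈ = lower F′ ε≤xy
          in ≤⇒≯ (W-≤ 0≤p p≤1 F″) (<-respˡ-≈ (sym costF″≈) (<-respʳ-≈ (unscale (W p))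
               (*-monoˡ-< 0<k⁻¹ (+-monoˡ-< (- (ε * fromℕ δ)) (≤-<-trans costF′≤ costF<target)))))

-- The numerical bound, and a window around a point above it.

module Threshold (ℝ : RealNumbers) where
  open RealNumbers ℝ
  open RealArithmetic ℝ

  -- The surplus that the four cells of `crossing-mass` must hold, with n times (1-q)/n simplified
  -- to 1-q.
  excess : ℕ → ℕ → Carrier → Carrier
  excess n m q = ((1# - q) / fromℕ n + (1# - q) / fromℕ m + q) - (1# - q)

  abstract
    ⁻¹-≤1 : ∀ {x} → 1# ≤ x → x ⁻¹ ≤ 1#
    ⁻¹-≤1 {x} 1≤x = *-cancelˡ-≤ 0<x (≤-respˡ-≈ (sym (*-inverseʳ (pos⇒≉0 0<x))) (≤-respʳ-≈ (sym (*-identityʳ x)) 1≤x))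
      where
      0<x : 0# < x
      0<x = <-≤-trans 0<1 1≤x

    half+half : ½ + ½ ≈ 1#
    half+half = trans (solve 1 (λ h → (:1 :* h) :+ (:1 :* h) := (:1 :+ (:1 :+ :0)) :* h) refl (fromℕ 2 ⁻¹))
      (*-inverseʳ (pos⇒≉0 (fromℕ-pos 1)))

    *-cancel-pos : ∀ {z x} → 0# ≤ z → 0# < z * x → 0# < x
    *-cancel-pos {z} 0≤z 0<zx = *-cancelˡ-< 0≤z (<-respˡ-≈ (sym (zeroʳ z)) 0<zx)

    above-threshold : ∀ {n m p} → 1 ℕ.≤ n → 1 ℕ.≤ m → p < 1# →
      let N = fromℕ n; M = fromℕ m in
      ½ - ½ * ((N + M) / (fromℕ 2 * N * M - N - M)) < p → 0# < excess n m p
    above-threshold {n} {m} {p} 1≤n 1≤m p<1 above = *-cancel-pos (<⇒≤ 0<NM)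
      (<-respʳ-≈ (sym NM*excess) ([ degenerate , generic ]′ (≤-or-> Q 0#)))
      where
      N M Q r : Carrier
      N = fromℕ n
      M = fromℕ m
      Q = fromℕ 2 * N * M - N - M
      r = (N + M) / Q

      0<N : 0# < N
      0<N = <-≤-trans 0<1 (1≤fromℕ 1≤n)
      0<M : 0# < M
      0<M = <-≤-trans 0<1 (1≤fromℕ 1≤m)
      0<NM : 0# < N * M
      0<NM = *-pos 0<N 0<M

      NM*excess : N * M * excess n m p ≈ N * M - (1# - p) * Q
      NM*excess = trans
        (solve 5 (λ N M i j p → N :* M :* (((:1 :- p) :* i :+ (:1 :- p) :* j :+ p) :- (:1 :- p)) :=
                    (:1 :- p) :* (M :* (N :* i)) :+ (:1 :- p) :* (N :* (M :* j)) :+ N :* M :* (p :- (:1 :- p)))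
          refl N M (N ⁻¹) (M ⁻¹) p)
        (trans (+-congʳ (+-cong (*-congˡ (*-congˡ (*-inverseʳ (pos⇒≉0 0<N)))) (*-congˡ (*-congˡ (*-inverseʳ (pos⇒≉0 0<M))))))
          (solve 3 (λ N M p → (:1 :- p) :* (M :* :1) :+ (:1 :- p) :* (N :* :1) :+ N :* M :* (p :- (:1 :- p)) :=
                       N :* M :- (:1 :- p) :* ((:1 :+ (:1 :+ :0)) :* N :* M :- N :- M)) refl N M p))

      -- Q ≤ 0 happens only for n = m = 1, where the threshold is a junk value.
      degenerate : Q ≤ 0# → 0# < N * M - (1# - p) * Q
      degenerate Q≤0 = <-respʳ-≈ (solve 3 (λ c s Q → c :+ s :* (:0 :- Q) := c :- s :* Q) refl (N * M) (1# - p) Q)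
        (+-pos-nonNeg 0<NM (*-nonNeg (<⇒≤ (difference-pos p<1)) (difference-nonNeg Q≤0)))

      -- Twice the goal is 2 Q times the amount by which p exceeds the threshold, because Q + N + M
      -- = 2 N M.
      generic : 0# < Q → 0# < N * M - (1# - p) * Q
      generic 0<Q = *-cancel-pos (fromℕ-nonNeg 2) (<-respʳ-≈
        (trans (solve 6 (λ p h r N M Q → (:1 :+ (:1 :+ :0)) :* (Q :* (p :- (h :- h :* r))) :=
                  (:1 :+ (:1 :+ :0)) :* (Q :* p) :- (h :+ h) :* Q :+ (h :+ h) :* (Q :* r)) refl p ½ r N M Q)
          (trans (+-cong (+-congˡ (-‿cong (*-congʳ half+half))) (*-cong half+half (/-*-cancel (pos⇒≉0 0<Q))))
            (solve 3 (λ p N M → (:1 :+ (:1 :+ :0)) :* (((:1 :+ (:1 :+ :0)) :* N :* M :- N :- M) :* p) :- :1 :* ((:1 :+ (:1 :+ :0)) :* N :* M :- N :- M) :+ :1 :* (N :+ M)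
                := (:1 :+ (:1 :+ :0)) :* (N :* M :- (:1 :- p) :* ((:1 :+ (:1 :+ :0)) :* N :* M :- N :- M))) refl p N M)))
        (*-pos (fromℕ-pos 1) (*-pos 0<Q (difference-pos above))))

  module Neighbourhood {n m p} (1≤n : 1 ℕ.≤ n) (1≤m : 1 ℕ.≤ m)
    (0<p : 0# < p) (p<1 : p < 1#) (0<excess : 0# < excess n m p) where

    abstract
      -- `e` will bound both ε and the radius η. In `2 + n`, n + 1 cells take ε each and one more e
      -- covers q > p - e. In 6, four go to the cells of `crossing-mass` and two to the drop of
      -- `excess` between p and q.
      step : ∃ λ e → 0# < e × (fromℕ (2 ℕ.+ n) * e ≤ p × fromℕ (2 ℕ.+ m) * e ≤ p) × fromℕ 6 * e ≤ excess n m p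
      step =
        let e₁ , 0<e₁ , le₁ = small-multiple (2 ℕ.+ n) 0<p
            e₂ , 0<e₂ , le₂ = small-multiple (2 ℕ.+ m) 0<p
            e₃ , 0<e₃ , le₃ = small-multiple 6 0<excess
            e₁₂ , 0<e₁₂ , e₁₂≤e₁ , e₁₂≤e₂ = lower-bound 0<e₁ 0<e₂
            e , 0<e , e≤e₁₂ , e≤e₃ = lower-bound 0<e₁₂ 0<e₃
        in e , 0<e ,
           (≤-trans (*-monoˡ-≤ (fromℕ-nonNeg (2 ℕ.+ n)) (≤-trans e≤e₁₂ e₁₂≤e₁)) le₁ ,
            ≤-trans (*-monoˡ-≤ (fromℕ-nonNeg (2 ℕ.+ m)) (≤-trans e≤e₁₂ e₁₂≤e₂)) le₂) ,
           ≤-trans (*-monoˡ-≤ (fromℕ-nonNeg 6) e≤e₃) le₃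

      e : Carrier
      e = proj₁ step

      0<e : 0# < e
      0<e = proj₁ (proj₂ step)

      n-bound : fromℕ (2 ℕ.+ n) * e ≤ p
      n-bound = proj₁ (proj₁ (proj₂ (proj₂ step)))

      m-bound : fromℕ (2 ℕ.+ m) * e ≤ p
      m-bound = proj₂ (proj₁ (proj₂ (proj₂ step)))

      excess-bound : fromℕ 6 * e ≤ excess n m p
      excess-bound = proj₂ (proj₂ (proj₂ step))

      -- The window from p - η to p + η has width 2η, so ε is at most 2η/(1-p₁), which this keeps
      -- below e since 1-p ≤ 1-p₁.
      radius : ∃ λ η → 0# < η × fromℕ 2 * η ≤ (1# - p) * e
      radius = small-multiple 2 (*-pos (difference-pos p<1) 0<e)

      η : Carrier
      η = proj₁ radius

      0<η : 0# < η
      0<η = proj₁ (proj₂ radius)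

      2η≤[1-p]e : fromℕ 2 * η ≤ (1# - p) * e
      2η≤[1-p]e = proj₂ (proj₂ radius)

      η≤e : η ≤ e
      η≤e = ≤-difference (+-nonNeg (+-nonNeg (difference-nonNeg 2η≤[1-p]e) (<⇒≤ (*-pos 0<p 0<e))) (<⇒≤ 0<η))
        (solve 3 (λ p e η → (((:1 :- p) :* e :- (:1 :+ (:1 :+ :0)) :* η) :+ p :* e) :+ η := e :- η) refl p e η)

      e≤p : e ≤ p
      e≤p = ≤-difference (+-nonNeg (difference-nonNeg n-bound) (*-nonNeg (fromℕ-nonNeg (suc n)) (<⇒≤ 0<e)))
        (solve 3 (λ p e n → (p :- (:1 :+ (:1 :+ n)) :* e) :+ (:1 :+ n) :* e := p :- e) refl p e (fromℕ n))

    p₁ p₂ : Carrier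
    p₁ = p - η
    p₂ = p + η

    abstract
      0≤p₁ : 0# ≤ p₁
      0≤p₁ = difference-nonNeg (≤-trans η≤e e≤p)

      p₁<p : p₁ < p
      p₁<p = <-difference 0<η (solve 2 (λ p η → η := p :- (p :- η)) refl p η)

      p<p₂ : p < p₂
      p<p₂ = <-difference 0<η (solve 2 (λ p η → η := (p :+ η) :- p) refl p η)

      p₂<1 : p₂ < 1#
      p₂<1 = <-difference (+-pos-nonNeg 0<η (+-nonNeg (difference-nonNeg 2η≤[1-p]e)
          (*-nonNeg (<⇒≤ (difference-pos p<1)) (difference-nonNeg (≤-trans e≤p (<⇒≤ p<1))))))
        (solve 3 (λ p e η → η :+ (((:1 :- p) :* e :- (:1 :+ (:1 :+ :0)) :* η) :+ (:1 :- p) :* (:1 :- e)) := :1 :- (p :+ η)) refl p e η)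

    module Inside {q} (p₁<q : p₁ < q) (q<p₂ : q < p₂) where
      q<1 : q < 1#
      q<1 = <-trans q<p₂ p₂<1

      ε : Carrier
      ε = (q - p₁) / (1# - p₁)

      abstract
        0<1-p₁ : 0# < 1# - p₁
        0<1-p₁ = difference-pos (<-trans p₁<q q<1)

        ε≤e : ε ≤ e
        ε≤e = *-cancelˡ-≤ 0<1-p₁ (≤-respˡ-≈ (sym (/-*-cancel (pos⇒≉0 0<1-p₁))) (≤-difference
          (+-nonNeg (+-nonNeg (difference-nonNeg 2η≤[1-p]e) (<⇒≤ (difference-pos q<p₂))) (<⇒≤ (*-pos 0<η 0<e)))
          (solve 4 (λ p e η q → (((:1 :- p) :* e :- (:1 :+ (:1 :+ :0)) :* η) :+ ((p :+ η) :- q)) :+ η :* e :=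
                      (:1 :- (p :- η)) :* e :- (q :- (p :- η))) refl p e η q)))

        small : ∀ l → fromℕ (2 ℕ.+ l) * e ≤ p → (fromℕ l + 1#) * ε ≤ q
        small l bound = ≤-difference
          (+-nonNeg (+-nonNeg (<⇒≤ (difference-pos p₁<q)) (difference-nonNeg bound))
            (+-nonNeg (difference-nonNeg η≤e) (*-nonNeg (+-nonNeg (fromℕ-nonNeg l) (<⇒≤ 0<1)) (difference-nonNeg ε≤e))))
          (solve 6 (λ p e η q ε l → ((q :- (p :- η)) :+ (p :- (:1 :+ (:1 :+ l)) :* e)) :+ ((e :- η) :+ (l :+ :1) :* (e :- ε)) :=
                      q :- (l :+ :1) :* ε) refl p e η q ε (fromℕ l))

        -- `excess` has slope 2 - 1/n - 1/m, between 0 and 2, so at q > p - η it has dropped by at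
        -- most 2η ≤ 2e from its value at p, and 4e ≥ 4ε remains.
        crossing : (1# - q) + fromℕ 4 * ε ≤ (1# - q) / fromℕ n + (1# - q) / fromℕ m + q
        crossing = ≤-difference
          (+-nonNeg (+-nonNeg (difference-nonNeg excess-bound) (*-nonNeg (fromℕ-nonNeg 4) (difference-nonNeg ε≤e)))
            (+-nonNeg (*-nonNeg (<⇒≤ (difference-pos p₁<q)) (+-nonNeg (difference-nonNeg (⁻¹-≤1 1≤N)) (difference-nonNeg (⁻¹-≤1 1≤M))))
              (+-nonNeg (*-nonNeg (fromℕ-nonNeg 2) (difference-nonNeg η≤e))
                (*-nonNeg (<⇒≤ 0<η) (+-nonNeg (<⇒≤ (⁻¹-pos (<-≤-trans 0<1 1≤N))) (<⇒≤ (⁻¹-pos (<-≤-trans 0<1 1≤M))))))))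
          (solve 7 (λ p e η q ε i j →
              ((((((:1 :- p) :* i :+ (:1 :- p) :* j :+ p) :- (:1 :- p)) :- (:1 :+ (:1 :+ :4)) :* e) :+ :4 :* (e :- ε))
               :+ ((q :- (p :- η)) :* ((:1 :- i) :+ (:1 :- j)) :+ (:2 :* (e :- η) :+ η :* (i :+ j))))
              := ((:1 :- q) :* i :+ (:1 :- q) :* j :+ q) :- ((:1 :- q) :+ :4 :* ε))
            refl p e η q ε (fromℕ n ⁻¹) (fromℕ m ⁻¹))
          where
          1≤N : 1# ≤ fromℕ n
          1≤N = 1≤fromℕ 1≤n
          1≤M : 1# ≤ fromℕ m
          1≤M = 1≤fromℕ 1≤m
          :2 :4 : ∀ {l} → Polynomial l
          :2 = :1 :+ (:1 :+ :0)
          :4 = :1 :+ (:1 :+ :2)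

theorem4p1 : (ℝ : RealNumbers) (G : LocallyFiniteGraph) →
    let open RealNumbers ℝ
        open LocallyFiniteGraph G
        open Curvature ℝ G
        d = λ (v : V) → fromℕ (degree v)
    in
    (x y : V) (δ : ℕ) (d[x,y]≡δ : IsDistance x y δ) → 2 ℕ.≤ δ →
    (p* : Carrier) → IsCriticalPoint (κ d[x,y]≡δ) p* →
    p* ≤ ½ - ½ * ((d x + d y) / (fromℕ 2 * d x * d y - d x - d y))
theorem4p1 ℝ G x y δ isDistance 2≤δ p* critical@(0<p* , p*<1 , _) = ≮⇒≥ λ above →
  let open Neighbourhood 1≤degree-x 1≤degree-y 0<p* p*<1 (above-threshold 1≤degree-x 1≤degree-y p*<1 above)
      u = (1# - p₁) ⁻¹
      D = fromℕ δ
  -- Slope and intercept result from collecting q in 1 - ((1-q) u W(p₁) + (q-p₁) u D)/D, where p₁ is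
  -- the same for all q in the window.
  in affine⇒¬critical {σ = (W p₁ - D) * u * D ⁻¹} {β = 1# - (W p₁ - p₁ * D) * u * D ⁻¹}
      (λ q p₁<q q<p₂ →
        let open Inside p₁<q q<p₂ in
        trans (+-congˡ (-‿cong (*-congʳ (Interpolation.W-interpolation 0≤p₁ p₁<q q<1
            (small (degree x) n-bound) (small (degree y) m-bound) crossing))))
          (solve 6 (λ q p w u D D⁻¹ → :1 :- (((:1 :- q) :* u) :* w :+ ((q :- p) :* u) :* D) :* D⁻¹ :=
                      (w :- D) :* u :* D⁻¹ :* q :+ (:1 :- (w :- p :* D) :* u :* D⁻¹)) refl q p₁ (W p₁) u D (D ⁻¹)))
      p₁<p p<p₂ critical
  where
  open RealNumbers ℝ
  open RealArithmetic ℝ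
  open AffineFunctions ℝ
  open Threshold ℝ
  open LocallyFiniteGraph G
  open GraphDistance ℝ G
  open Between isDistance 2≤δ
  open TransportDistance ℝ G isDistance 2≤δ
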